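{- (i) Let $G$ be a finite graph and $X,Y\subseteq V(G)$. If there exists a collection $\mathcal P$ of five pairwise vertex-disjoint $X$-$Y$-paths in $G$ such that every vertex in $V(\mathcal P)$ is incident to at most one edge in $E(G)\setminus E(\mathcal P)$, then there exist two non-adjacent $X$-$Y$-paths in $G$. (ii) There exist a finite graph $G$, sets $X,Y\subseteq V(G)$ and a collection $\mathcal P$ of four pairwise vertex-disjoint $X$-$Y$-paths in $G$ such that every vertex in $V(\mathcal P)$ is incident to at most one edge in $E(G)\setminus E(\mathcal P)$, but $G$ does not contain two non-adjacent $X$-$Y$-paths. (iii) There exist a finite graph $G$ of maximum degree three, sets $X,Y\subseteq V(G)$ and a collection of five pairwise vertex-disjoint $X$-$Y$-paths in $G$, but $G$ does not contain two non-adjacent $X$-$Y$-paths.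
   Context: An $X$-$Y$-path is a path with one endpoint in $X$ and the other endpoint in $Y$; a single vertex of $X\cap Y$ counts as an $X$-$Y$-path (of length $0$). For a collection $\mathcal P$ of paths, $V(\mathcal P)=\bigcup_{P\in\mathcal P}V(P)$ and $E(\mathcal P)=\bigcup_{P\in\mathcal P}E(P)$. Two paths are non-adjacent if they are vertex-disjoint and no edge of $G$ joins a vertex of one to a vertex of the other. -}

module Defs where

open import Data.Nat using (ℕ; _≤_)
open import Data.Fin using (Fin)
open import Data.Bool using (Bool; true; false)
open import Data.List using (List; []; _∷_)
open import Data.List.NonEmpty using (List⁺; _∷_; head; last; toList)
open import Data.List.Membership.Propositional using (_∈_)
open import Data.List.Relation.Unary.Unique.Propositional using (Unique)
open import Data.Vec using (tabulate)
open import Data.Fin.Subset using (∣_∣)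
open import Data.Product using (Σ; ∃; _×_; _,_)
open import Data.Sum using (_⊎_)
open import Data.Unit using (⊤)
open import Relation.Nullary using (¬_)
open import Relation.Binary.PropositionalEquality using (_≡_; _≢_)

record Graph (n : ℕ) : Set where
  field
    adj    : Fin n → Fin n → Bool
    sym    : ∀ u v → adj u v ≡ adj v u
    irrefl : ∀ v → adj v v ≡ false

open Graph public

Adj : ∀ {n} → Graph n → Fin n → Fin n → Set
Adj G u v = adj G u v ≡ true

VSet : ℕ → Set₁
VSet n = Fin n → Set

Walk : ∀ {n} → Graph n → List (Fin n) → Set
Walk G []           = ⊤
Walk G (x ∷ [])     = ⊤
Walk G (x ∷ y ∷ r)  = Adj G x y × Walk G (y ∷ r)

record Path {n : ℕ} (G : Graph n) : Set where
  constructor mkPath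
  field
    verts    : List⁺ (Fin n)
    distinct : Unique (toList verts)
    walk     : Walk G (toList verts)

open Path public

_∈V_ : ∀ {n} {G : Graph n} → Fin n → Path G → Set
v ∈V P = v ∈ toList (verts P)

data Consec {A : Set} : List A → A → A → Set where
  here  : ∀ {x y r} → Consec (x ∷ y ∷ r) x y
  there : ∀ {x r u v} → Consec r u v → Consec (x ∷ r) u v

EdgeOf : ∀ {n} {G : Graph n} → Path G → Fin n → Fin n → Set
EdgeOf P u v = Consec (toList (verts P)) u v ⊎ Consec (toList (verts P)) v u

-- P is an X-Y-path: one endpoint in X, the other in Y
-- (a single vertex of X ∩ Y is covered by the first disjunct)
IsXYPath : ∀ {n} {G : Graph n} → VSet n → VSet n → Path G → Set
IsXYPath X Y P =
  (X (head (verts P)) × Y (last (verts P))) ⊎ (Y (head (verts P)) × X (last (verts P)))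

VertexDisjoint : ∀ {n} {G : Graph n} → Path G → Path G → Set
VertexDisjoint P Q = ∀ v → v ∈V P → ¬ (v ∈V Q)

NonAdjacent : ∀ {n} {G : Graph n} → Path G → Path G → Set
NonAdjacent {G = G} P Q =
  VertexDisjoint P Q × (∀ u v → u ∈V P → v ∈V Q → ¬ Adj G u v)

HasTwoNonAdjacentXYPaths : ∀ {n} → Graph n → VSet n → VSet n → Set
HasTwoNonAdjacentXYPaths G X Y =
  Σ (Path G) λ P → Σ (Path G) λ Q →
    IsXYPath X Y P × IsXYPath X Y Q × NonAdjacent P Q

DisjointXYPaths : ∀ {n} (G : Graph n) → VSet n → VSet n → (k : ℕ) → (Fin k → Path G) → Set
DisjointXYPaths G X Y k 𝒫 =
  (∀ i → IsXYPath X Y (𝒫 i)) × (∀ i j → i ≢ j → VertexDisjoint (𝒫 i) (𝒫 j))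

InV𝒫 : ∀ {n} {G : Graph n} {k} → (Fin k → Path G) → Fin n → Set
InV𝒫 𝒫 v = ∃ λ i → v ∈V 𝒫 i

InE𝒫 : ∀ {n} {G : Graph n} {k} → (Fin k → Path G) → Fin n → Fin n → Set
InE𝒫 𝒫 u v = ∃ λ i → EdgeOf (𝒫 i) u v

FewExtraEdges : ∀ {n} (G : Graph n) {k} → (Fin k → Path G) → Set
FewExtraEdges G 𝒫 =
  ∀ v → InV𝒫 𝒫 v →
    ∀ w w' → Adj G v w → ¬ InE𝒫 𝒫 v w → Adj G v w' → ¬ InE𝒫 𝒫 v w' → w ≡ w'

degree : ∀ {n} → Graph n → Fin n → ℕ
degree G v = ∣ tabulate (adj G v) ∣

MaxDegree : ∀ {n} → Graph n → ℕ → Set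
MaxDegree G d = (∀ v → degree G v ≤ d) × (∃ λ v → degree G v ≡ d)

{-# OPTIONS --safe #-}

-- (i) Walk along the five paths (the strands) from X to Y simultaneously, keeping track of the pairs
-- of strands that two non-adjacent partial paths can have reached. A tip without extra edge is
-- skipped. Two tips joined by an extra edge are passed together; there a partial path may change
-- strands, and pairs get lost. If neither applies, the extra edge of every tip leads deeper into some
-- strand, and following these edges closes a cycle of strands. Rerouting the strands along the extra
-- edges of this cycle leaves out some vertices, unless each of the edges ends in the second vertex of
-- its strand; in that case the first two vertices of the strands form chordless cycles of G, which
-- are passed in one step. Up to renaming the strands and forgetting pairs, fourteen sets of pairs
-- suffice to describe all that can happen, and the empty set is not one of them.
-- (ii) With four strands, sixteen well-chosen meetings exhaust all pairs.
-- (iii) In the Petersen graph, let the five paths be the spokes of the usual drawing: every X-Y-path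
-- contains a spoke, and any two spokes are joined by an edge.

module Submission where

open import Defs
open import Data.Nat using (ℕ)
open import Data.Fin using (Fin)
open import Data.Product using (Σ; _×_)
open import Relation.Nullary using (¬_)

open import Data.Bool using (Bool; true; false; not; T; _∧_; _∨_; if_then_else_) renaming (_≟_ to _≟ᵇ_)
open import Data.Bool.ListAction using (all; any)
open import Data.Bool.Properties using (T-∧; T-∨; T-≡; T-not-≡)
open import Data.Empty using (⊥)
open import Data.Fin using (zero; suc; toℕ; #_; opposite)
open import Data.Fin.Properties using (_≟_; pigeonhole; suc-injective; toℕ-injective) renaming (any? to anyFin?; all? to allFin?)
open import Data.Fin.Subset using (Subset; ∣_∣; _-_) renaming (_∈_ to _∈ₛ_; ⊤ to full)
open import Data.Fin.Subset.Properties using (x∈p⇒∣p-x∣<∣p∣; x∈p∧x≢y⇒x∈p-y; ∈⊤)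
open import Data.List as List using (List; []; _∷_; _++_; head; foldl; reverse; map; concatMap; filter; cartesianProduct; allFin; null; take; drop; initLast; _∷ʳ′_)
open import Data.List.Membership.DecPropositional using () renaming (_∈?_ to member?)
open import Data.List.Membership.Propositional using (_∈_; _∉_; find)
open import Data.List.Membership.Propositional.Properties using (∈-++⁺ˡ; ∈-++⁺ʳ; ∈-++⁻; ∈-∃++; ∈-map⁺; ∈-map⁻; ∈-filter⁺; ∈-filter⁻; ∈-concatMap⁺; ∈-concatMap⁻; ∈-allFin; ∈-cartesianProduct⁺; ∈-tabulate⁺)
open import Data.List.NonEmpty as List⁺ using (List⁺; _∷_; toList; last)
open import Data.List.Properties using (∷-injectiveˡ; ∷-injectiveʳ; take++drop≡id)
open import Data.List.Relation.Binary.Permutation.Propositional using (↭-sym; ↭⇒↭ₛ)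
open import Data.List.Relation.Binary.Permutation.Propositional.Properties using (↭-reverse; ∈-resp-↭)
import Data.List.Relation.Binary.Permutation.Setoid.Properties as SetoidPermutation
open import Data.List.Relation.Unary.All as All using (All; []; _∷_; all?)
open import Data.List.Relation.Unary.All.Properties using (all⁺)
open import Data.List.Relation.Unary.AllPairs using ([]; _∷_)
open import Data.List.Relation.Unary.Any as Any using (Any; here; there)
open import Data.List.Relation.Unary.Any.Properties using (any⁺; any⁻)
open import Data.List.Relation.Unary.Unique.DecPropositional using (unique?)
open import Data.List.Relation.Unary.Unique.Propositional using (Unique)
import Data.List.Relation.Unary.Unique.Propositional.Properties as Unique
open import Data.Maybe using (just)
open import Data.Maybe.Properties using (just-injective)
open import Data.Nat using (zero; suc; _+_; _<_; s≤s; _≤?_; _≡ᵇ_)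
open import Data.Nat.Properties using (+-comm; n<1+n; <-≤-trans; m≤n⇒∃[o]m+o≡n; ≡ᵇ⇒≡; ≡⇒≡ᵇ)
open import Data.Product using (∃; ∃₂; _,_; proj₁; proj₂; swap)
open import Data.Sum as Sum using (_⊎_; inj₁; inj₂)
open import Data.Unit using (⊤; tt)
open import Data.Vec using (Vec; []; _∷_; lookup; tabulate) renaming (toList to toListᵛ)
open import Data.Vec.Properties using (lookup∘tabulate)
open import Function using (_∘_; const; flip)
open import Function.Bundles using (Equivalence)
open import Relation.Binary.Definitions using (DecidableEquality)
open import Relation.Binary.PropositionalEquality using (_≡_; _≢_; refl; trans; cong; subst; setoid) renaming (sym to ≡-sym)
open import Relation.Nullary using (Dec; yes; no; contradiction; T?)
open import Relation.Nullary.Decidable using (map′; _×-dec_; _⊎-dec_; _→-dec_; ¬?; True; toWitness; from-yes; decidable-stable)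
open import Relation.Unary using (Decidable)

-- Consecutive elements of lists

module _ {A : Set} where

  head-∈ : ∀ {xs : List A} {v} → head xs ≡ just v → v ∈ xs
  head-∈ {x ∷ xs} refl = here refl

  unique-∷ : ∀ {x : A} {xs} → Unique (x ∷ xs) → x ∉ xs
  unique-∷ (x≢ ∷ _) x∈ = All.lookup x≢ x∈ refl

  unique-++ : ∀ xs {ys : List A} {v} → Unique (xs ++ ys) → v ∈ xs → v ∉ ys
  unique-++ (x ∷ xs) u        (here refl) v∈ = unique-∷ u (∈-++⁺ʳ xs v∈)
  unique-++ (x ∷ xs) (_ ∷ u)  (there v∈′) v∈ = unique-++ xs u v∈′ v∈

  unique-suffix : ∀ xs {ys : List A} → Unique (xs ++ ys) → Unique ys
  unique-suffix []       u       = u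
  unique-suffix (x ∷ xs) (_ ∷ u) = unique-suffix xs u

  consec-∷⁻ : ∀ {x : A} {xs u v} → Consec (x ∷ xs) u v →
              (u ≡ x × head xs ≡ just v) ⊎ Consec xs u v
  consec-∷⁻ here      = inj₁ (refl , refl)
  consec-∷⁻ (there c) = inj₂ c

  consec-∈ˡ : ∀ {xs : List A} {u v} → Consec xs u v → u ∈ xs
  consec-∈ˡ here      = here refl
  consec-∈ˡ (there c) = there (consec-∈ˡ c)

  consec-∈ʳ : ∀ {xs : List A} {u v} → Consec xs u v → v ∈ xs
  consec-∈ʳ here      = there (here refl)
  consec-∈ʳ (there c) = there (consec-∈ʳ c)

  consec-++⁺ʳ : ∀ xs {ys : List A} {u v} → Consec ys u v → Consec (xs ++ ys) u v
  consec-++⁺ʳ []       c = c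
  consec-++⁺ʳ (x ∷ xs) c = there (consec-++⁺ʳ xs c)

  consec-suffix : ∀ xs {ys : List A} {u v} → Unique (xs ++ ys) →
                  Consec (xs ++ ys) u v → u ∈ ys → Consec ys u v
  consec-suffix []       _ c _ = c
  consec-suffix (x ∷ xs) u@(_ ∷ u′) c u∈ with consec-∷⁻ c
  ... | inj₁ (refl , _) = contradiction (∈-++⁺ʳ xs u∈) (unique-∷ u)
  ... | inj₂ c′         = consec-suffix xs u′ c′ u∈

  -- Entries do not repeat, so a single pair leads out of `xs`. This is why the new tip is the only
  -- vertex of a shortened strand that the removed part can see along the strand.
  consec-boundary : ∀ xs {ys : List A} {u v} → Unique (xs ++ ys) →
                    Consec (xs ++ ys) u v → u ∈ xs → v ∈ ys → head ys ≡ just v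
  consec-boundary (x ∷ xs) u@(_ ∷ u′) c u∈ v∈ with consec-∷⁻ c
  consec-boundary (x ∷ [])     u@(_ ∷ u′) c u∈ v∈ | inj₁ (_ , eq)   = eq
  consec-boundary (x ∷ y ∷ xs) u@(_ ∷ u′) c u∈ v∈ | inj₁ (_ , refl) =
    contradiction v∈ (unique-++ (y ∷ xs) u′ (here refl))
  consec-boundary (x ∷ xs) u@(_ ∷ u′) c (here refl) v∈ | inj₂ c′ =
    contradiction (consec-∈ˡ c′) (unique-∷ u)
  consec-boundary (x ∷ xs) u@(_ ∷ u′) c (there u∈) v∈ | inj₂ c′ = consec-boundary xs u′ c′ u∈ v∈

  consec-suffix-∷ : ∀ xs {y : A} {ys u v} → Unique (xs ++ y ∷ ys) →
                    Consec (xs ++ y ∷ ys) u v → v ∈ ys → Consec (y ∷ ys) u v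
  consec-suffix-∷ []       _ c _ = c
  consec-suffix-∷ (x ∷ xs) u@(_ ∷ u′) c v∈ with consec-∷⁻ c
  ... | inj₂ c′ = consec-suffix-∷ xs u′ c′ v∈
  consec-suffix-∷ (x ∷ [])     u@(_ ∷ u′) c v∈ | inj₁ (_ , refl) = contradiction v∈ (unique-∷ u′)
  consec-suffix-∷ (x ∷ z ∷ xs) u@(_ ∷ u′) c v∈ | inj₁ (_ , refl) =
    contradiction (there v∈) (unique-++ (z ∷ xs) u′ (here refl))

  consec-¬head : ∀ {xs : List A} {u v} → Unique xs → head xs ≡ just v → ¬ Consec xs u v
  consec-¬head {_ ∷ _} u refl c with consec-∷⁻ c
  ... | inj₁ (_ , eq) = unique-∷ u (head-∈ eq)
  ... | inj₂ c′       = unique-∷ u (consec-∈ʳ c′)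

  consec-pred : ∀ {xs : List A} {u u′ v} → Unique xs → Consec xs u v → Consec xs u′ v → u ≡ u′
  consec-pred (_ ∷ u) here c′ with consec-∷⁻ c′
  ... | inj₁ (refl , _) = refl
  ... | inj₂ c″         = contradiction c″ (consec-¬head u refl)
  consec-pred (_ ∷ u) (there c) c′ with consec-∷⁻ c′
  ... | inj₁ (_ , eq) = contradiction c (consec-¬head u eq)
  ... | inj₂ c″       = consec-pred u c c″

  consec? : DecidableEquality A → ∀ xs (u v : A) → Dec (Consec xs u v)
  consec? _≟_ []       u v = no λ ()
  consec? _≟_ (x ∷ []) u v = no λ { (there ()) }
  consec? _≟_ (x ∷ y ∷ xs) u v =
    map′ (λ { (inj₁ (refl , refl)) → here ; (inj₂ c) → there c })
         (λ { here → inj₁ (refl , refl) ; (there c) → inj₂ c })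
         (((x ≟ u) ×-dec (y ≟ v)) ⊎-dec consec? _≟_ (y ∷ xs) u v)

  -- Since `reverse` is a `foldl`, the induction needs an arbitrary accumulator: the pair is either
  -- already reversed in it or still ahead.
  foldl-consec : ∀ xs {x : A} {acc u v} → Consec (x ∷ acc) v u ⊎ Consec (x ∷ xs) u v →
                 Consec (foldl (flip _∷_) (x ∷ acc) xs) v u
  foldl-consec []       (inj₁ c)           = c
  foldl-consec []       (inj₂ (there ()))
  foldl-consec (y ∷ xs) (inj₁ c)           = foldl-consec xs (inj₁ (there c))
  foldl-consec (y ∷ xs) (inj₂ here)        = foldl-consec xs (inj₁ here)
  foldl-consec (y ∷ xs) (inj₂ (there c))   = foldl-consec xs (inj₂ c)

  last-∷ : ∀ (x y : A) xs → last (x ∷ y ∷ xs) ≡ last (y ∷ xs)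
  last-∷ x y xs with initLast xs
  ... | []       = refl
  ... | _ ∷ʳ′ _ = refl

  head-foldl : ∀ (x : A) acc xs → head (foldl (flip _∷_) (x ∷ acc) xs) ≡ just (last (x ∷ xs))
  head-foldl x acc []       = refl
  head-foldl x acc (y ∷ xs) = trans (head-foldl y (x ∷ acc) xs) (cong just (≡-sym (last-∷ x y xs)))

  unique-reverse : ∀ {xs : List A} → Unique xs → Unique (reverse xs)
  unique-reverse {xs} = SetoidPermutation.Unique-resp-↭ (setoid A) (↭⇒↭ₛ (↭-sym (↭-reverse xs)))

-- Routes

module _ {n} (G : Graph n) (Y : VSet n) where

  -- With the empty list as a route, every suffix of a route is a route, and a used-up strand needs
  -- no special treatment.
  data Route : List (Fin n) → Set where
    []  : Route []
    end : ∀ {v} → Y v → Route (v ∷ [])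
    _∷_ : ∀ {u v vs} → Adj G u v → Route (v ∷ vs) → Route (u ∷ v ∷ vs)

module _ {n} {G : Graph n} where

  adj-sym : ∀ {u v} → Adj G u v → Adj G v u
  adj-sym {u} {v} = trans (≡-sym (sym G u v))

  adj-irrefl : ∀ {v} → ¬ Adj G v v
  adj-irrefl {v} p with trans (≡-sym p) (irrefl G v)
  ... | ()

module _ {n} {G : Graph n} {Y : VSet n} where

  route-tail : ∀ {v vs} → Route G Y (v ∷ vs) → Route G Y vs
  route-tail (end _) = []
  route-tail (_ ∷ r) = r

  route-suffix : ∀ us {vs} → Route G Y (us ++ vs) → Route G Y vs
  route-suffix []       r = r
  route-suffix (u ∷ us) r = route-suffix us (route-tail r)

  -- Only the first vertex of `us` matters for the edge at `v`. If `us` is empty, then so is `vs`,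
  -- and `v` itself lies in `Y`.
  route-graft : ∀ {v us vs} → Route G Y (v ∷ us) → head vs ≡ head us →
                Route G Y vs → Route G Y (v ∷ vs)
  route-graft {us = []}    {[]}    (end y) _    _ = end y
  route-graft {us = _ ∷ _} {_ ∷ _} (p ∷ _) refl r = p ∷ r

  walk⇒route : ∀ v vs → Walk G (v ∷ vs) → Y (last (v ∷ vs)) → Route G Y (v ∷ vs)
  walk⇒route v []       _       y = end y
  walk⇒route v (w ∷ vs) (p , r) y = p ∷ walk⇒route w vs r (subst Y (last-∷ v w vs) y)

  route⇒walk : ∀ {vs} → Route G Y vs → Walk G vs
  route⇒walk []            = _
  route⇒walk (end _)       = _
  route⇒walk (p ∷ r)       = p , route⇒walk r

  route⇒last : ∀ {v vs} → Route G Y (v ∷ vs) → Y (last (v ∷ vs))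
  route⇒last (end y)                         = y
  route⇒last {u} (_∷_ {v = v} {vs = vs} _ r) = subst Y (≡-sym (last-∷ u v vs)) (route⇒last r)

  foldl-route : ∀ {v} vs {acc} → Walk G (v ∷ vs) → Route G Y (v ∷ acc) →
                Route G Y (foldl (flip _∷_) (v ∷ acc) vs)
  foldl-route []       _       r = r
  foldl-route (w ∷ vs) (p , q) r = foldl-route vs q (adj-sym {G = G} p ∷ r)

record Tour {n} {G : Graph n} (X Y : VSet n) (P : Path G) : Set where
  field
    {source} : Fin n
    tour     : List (Fin n)
    starts   : head tour ≡ just source
    source∈X : X source
    isRoute  : Route G Y tour
    isUnique : Unique tour
    inside   : ∀ {v} → v ∈ tour → v ∈V P
    edges    : ∀ {u v} → EdgeOf P u v → Consec tour u v ⊎ Consec tour v u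

orient : ∀ {n} {G : Graph n} {X Y : VSet n} (P : Path G) → IsXYPath X Y P → Tour X Y P
orient (mkPath (v ∷ vs) u w) (inj₁ (x , y)) = record
  { tour = v ∷ vs ; starts = refl ; source∈X = x ; isRoute = walk⇒route v vs w y
  ; isUnique = u ; inside = λ i → i ; edges = λ e → e }
orient {G = G} (mkPath (v ∷ vs) u w) (inj₂ (y , x)) = record
  { tour = reverse (v ∷ vs) ; starts = head-foldl v [] vs ; source∈X = x
  ; isRoute = foldl-route {G = G} vs w (end y)
  ; isUnique = unique-reverse u ; inside = ∈-resp-↭ (↭-reverse (v ∷ vs))
  ; edges = λ { (inj₁ c) → inj₂ (foldl-consec vs (inj₂ c))
              ; (inj₂ c) → inj₁ (foldl-consec vs (inj₂ c)) } }

-- States and events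

Strand : Set
Strand = Fin 5

_∈?_ : (k : Strand) (ks : List Strand) → Dec (k ∈ ks)
_∈?_ = member? _≟_

-- (i , ks) describes a partial path that has reached strand i and has used the last passed vertex of
-- each strand in ks (its trail), so that the other path must avoid the tips of the strands in ks.
Position : Set
Position = Strand × List Strand

Config : Set
Config = Position × Position

infix 3 _∥_
_∥_ : Position → Position → Config
_∥_ = _,_

State : Set
State = List Config

Perm : Set
Perm = Vec Strand 5

-- skip k: the tip of strand k has no extra edge.
-- meet k l: an extra edge joins the tips of strands k and l.
-- turn σ: for each i moved by σ, an extra edge joins the tip of strand i to the second vertex of
-- strand σ i; the first two vertices of the moved strands are passed.
data Event : Set where
  skip : Strand → Event
  meet : Strand → Strand → Event
  turn : Perm → Event

-- The ways of a partial path past an event: not involved, along its strand, or along the extra edge.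
data Move : Set where
  idle stay cross : Move

moves : List Move
moves = idle ∷ stay ∷ cross ∷ []

Touched : Event → Strand → Set
Touched (skip k)   i = i ≡ k
Touched (meet k l) i = i ≡ k ⊎ i ≡ l
Touched (turn σ)   i = lookup σ i ≢ i

touched? : ∀ e → Decidable (Touched e)
touched? (skip k)   i = i ≟ k
touched? (meet k l) i = (i ≟ k) ⊎-dec (i ≟ l)
touched? (turn σ)   i = ¬? (lookup σ i ≟ i)

Legal : Event → Move → Strand → Set
Legal e          idle  i = ¬ Touched e i
Legal e          stay  i = Touched e i
Legal (skip _)   cross i = ⊥
Legal (meet k l) cross i = Touched (meet k l) i
Legal (turn σ)   cross i = Touched (turn σ) i

legal? : ∀ e m → Decidable (Legal e m)
legal? e          idle  i = ¬? (touched? e i)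
legal? e          stay  i = touched? e i
legal? (skip _)   cross i = no λ ()
legal? (meet k l) cross i = touched? (meet k l) i
legal? (turn σ)   cross i = touched? (turn σ) i

other : Strand → Strand → Strand → Strand
other k l i with i ≟ k
... | yes _ = l
... | no  _ = k

exit : Event → Move → Strand → Strand
exit (meet k l) cross i = other k l i
exit (turn σ)   cross i = lookup σ i
exit _          _     i = i

-- A path that crosses in a meeting leaves its strand behind, and the vertex it leaves is adjacent
-- to the new tip there. In a turn the next vertex of the strand is passed as well, so nothing
-- remains to be avoided.
trail : Event → Move → Strand → List Strand
trail (meet _ _) cross i = i ∷ []
trail _          _     i = []

-- The strands whose tips are used by a move.
tips : Event → Move → Strand → List Strand
tips _          idle  i = []
tips _          stay  i = i ∷ []
tips (meet k l) cross i = k ∷ l ∷ []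
tips _          cross i = i ∷ []

-- In a skip or a meeting at most one of the two paths can take part. In a turn the tip of strand
-- `i` is adjacent to the second vertices of the strands `i` and `lookup σ i`; the inequalities keep
-- the other path off both, and vice versa.
Compatible : Event → Move → Strand → Move → Strand → Set
Compatible _        idle  _ _     _ = ⊤
Compatible _        stay  _ idle  _ = ⊤
Compatible _        cross _ idle  _ = ⊤
Compatible (turn σ) stay  i stay  j = i ≢ j × lookup σ i ≢ j × lookup σ j ≢ i
Compatible (turn σ) stay  i cross j = i ≢ j × lookup σ j ≢ i
Compatible (turn σ) cross i stay  j = i ≢ j × lookup σ i ≢ j
Compatible (turn σ) cross i cross j = i ≢ j × lookup σ i ≢ j × lookup σ j ≢ i
Compatible _        _     _ _     _ = ⊥

compatible? : ∀ e m i m′ j → Dec (Compatible e m i m′ j)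
compatible? _          idle  _ _     _ = yes tt
compatible? _          stay  _ idle  _ = yes tt
compatible? _          cross _ idle  _ = yes tt
compatible? (turn σ)   stay  i stay  j = ¬? (i ≟ j) ×-dec ¬? (lookup σ i ≟ j) ×-dec ¬? (lookup σ j ≟ i)
compatible? (turn σ)   stay  i cross j = ¬? (i ≟ j) ×-dec ¬? (lookup σ j ≟ i)
compatible? (turn σ)   cross i stay  j = ¬? (i ≟ j) ×-dec ¬? (lookup σ i ≟ j)
compatible? (turn σ)   cross i cross j = ¬? (i ≟ j) ×-dec ¬? (lookup σ i ≟ j) ×-dec ¬? (lookup σ j ≟ i)
compatible? (skip _)   stay  _ stay  _ = no λ ()
compatible? (skip _)   stay  _ cross _ = no λ ()
compatible? (skip _)   cross _ stay  _ = no λ ()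
compatible? (skip _)   cross _ cross _ = no λ ()
compatible? (meet _ _) stay  _ stay  _ = no λ ()
compatible? (meet _ _) stay  _ cross _ = no λ ()
compatible? (meet _ _) cross _ stay  _ = no λ ()
compatible? (meet _ _) cross _ cross _ = no λ ()

Admissible : Event → Config → Move × Move → Set
Admissible e ((i , s) , (j , t)) (m , m′) =
  Legal e m i × Legal e m′ j × Compatible e m i m′ j ×
  All (_∉ t) (tips e m i) × All (_∉ s) (tips e m′ j)

admissible? : ∀ e c → Decidable (Admissible e c)
admissible? e ((i , s) , (j , t)) (m , m′) =
  legal? e m i ×-dec legal? e m′ j ×-dec compatible? e m i m′ j ×-dec
  all? (λ k → ¬? (k ∈? t)) (tips e m i) ×-dec all? (λ k → ¬? (k ∈? s)) (tips e m′ j)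

-- A trail concerns present tips only, so it expires on every strand whose tip the event passes.
untouched : Event → List Strand → List Strand
untouched e = filter (¬? ∘ touched? e)

target : Event → Config → Move × Move → Config
target e ((i , s) , (j , t)) (m , m′) =
  (exit e m i , trail e m i ++ untouched e s) , (exit e m′ j , trail e m′ j ++ untouched e t)

successors : Event → Config → List Config
successors e c = map (target e c) (filter (admissible? e c) (cartesianProduct moves moves))

-- d ≼ c: having reached d is at least as good as having reached c.
_≼_ : Config → Config → Set
((i , s) , (j , t)) ≼ ((i′ , s′) , (j′ , t′)) = i ≡ i′ × j ≡ j′ × All (_∈ s′) s × All (_∈ t′) t

rename : Perm → Config → Config
rename π ((i , s) , (j , t)) = (lookup π i , map (lookup π) s) , (lookup π j , map (lookup π) t)

injections : ∀ l → List (Vec Strand l)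
injections zero    = [] ∷ []
injections (suc l) =
  concatMap (λ v → map (_∷ v) (filter (λ k → ¬? (k ∈? toListᵛ v)) (allFin 5))) (injections l)

events : List Event
events = map skip (allFin 5)
      ++ map (λ (k , l) → meet k l) (cartesianProduct (allFin 5) (allFin 5))
      ++ map turn (injections 5)

pattern ⓪ = zero
pattern ① = suc zero
pattern ② = suc (suc zero)
pattern ③ = suc (suc (suc zero))
pattern ④ = suc (suc (suc (suc zero)))

-- Found by computer, starting from the states that occur when all strands are at their beginnings and
-- discarding configurations and enlarging trails as long as the empty state stays out of reach.
family : Vec State 14
family =
  ((⓪ , [] ∥ ① , []) ∷ (⓪ , [] ∥ ② , []) ∷ (① , [] ∥ ④ , ⓪ ∷ []) ∷ (② , [] ∥ ③ , ⓪ ∷ ① ∷ []) ∷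
   []) ∷
  ((⓪ , [] ∥ ① , []) ∷ (⓪ , [] ∥ ② , []) ∷ (⓪ , [] ∥ ③ , ① ∷ []) ∷ (② , [] ∥ ④ , ⓪ ∷ []) ∷ []) ∷
  ((⓪ , [] ∥ ① , []) ∷ (⓪ , [] ∥ ② , []) ∷ (⓪ , [] ∥ ③ , ① ∷ []) ∷ (⓪ , [] ∥ ④ , ① ∷ ③ ∷ []) ∷
   []) ∷
  ((⓪ , [] ∥ ① , []) ∷ (⓪ , [] ∥ ② , ① ∷ []) ∷ (⓪ , [] ∥ ③ , ① ∷ ② ∷ []) ∷ (① , [] ∥ ④ , ⓪ ∷ []) ∷
   (② , ⓪ ∷ ① ∷ [] ∥ ④ , ⓪ ∷ []) ∷ []) ∷
  ((⓪ , [] ∥ ① , []) ∷ (⓪ , [] ∥ ② , ① ∷ []) ∷ (① , [] ∥ ③ , ⓪ ∷ []) ∷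
   (② , ⓪ ∷ ① ∷ [] ∥ ③ , ⓪ ∷ ④ ∷ []) ∷ (② , [] ∥ ④ , []) ∷ []) ∷
  ((⓪ , [] ∥ ① , []) ∷ (⓪ , [] ∥ ② , ① ∷ []) ∷ (⓪ , [] ∥ ③ , ① ∷ []) ∷ (⓪ , [] ∥ ④ , ① ∷ ② ∷ []) ∷
   (① , [] ∥ ② , ⓪ ∷ ④ ∷ []) ∷ (① , [] ∥ ④ , ⓪ ∷ []) ∷ []) ∷
  ((⓪ , [] ∥ ① , []) ∷ (⓪ , [] ∥ ② , []) ∷ (⓪ , [] ∥ ③ , ① ∷ []) ∷ (③ , [] ∥ ④ , ⓪ ∷ []) ∷ []) ∷
  ((⓪ , [] ∥ ① , []) ∷ (⓪ , [] ∥ ② , []) ∷ (⓪ , [] ∥ ③ , ① ∷ []) ∷ (⓪ , [] ∥ ④ , ② ∷ []) ∷ []) ∷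
  ((⓪ , [] ∥ ① , ② ∷ ④ ∷ []) ∷ (⓪ , [] ∥ ② , ① ∷ []) ∷ (⓪ , [] ∥ ③ , ① ∷ []) ∷
   (⓪ , ① ∷ [] ∥ ④ , ① ∷ ② ∷ []) ∷ (⓪ , ② ∷ [] ∥ ④ , ① ∷ ③ ∷ []) ∷ (① , [] ∥ ② , ⓪ ∷ []) ∷
   (① , [] ∥ ③ , ⓪ ∷ []) ∷ (① , [] ∥ ④ , ⓪ ∷ ② ∷ []) ∷ (① , [] ∥ ④ , ⓪ ∷ ③ ∷ []) ∷ []) ∷
  ((⓪ , [] ∥ ① , []) ∷ (⓪ , [] ∥ ② , ① ∷ []) ∷ (⓪ , [] ∥ ③ , ① ∷ ② ∷ []) ∷
   (① , [] ∥ ② , ⓪ ∷ ③ ∷ []) ∷ (① , [] ∥ ③ , ⓪ ∷ []) ∷ (② , [] ∥ ④ , []) ∷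
   (③ , ② ∷ [] ∥ ④ , ① ∷ []) ∷ []) ∷
  ((⓪ , [] ∥ ① , []) ∷ (⓪ , [] ∥ ② , []) ∷ (⓪ , [] ∥ ③ , ① ∷ []) ∷ (① , [] ∥ ④ , []) ∷ []) ∷
  ((⓪ , [] ∥ ① , []) ∷ (⓪ , [] ∥ ② , []) ∷ (⓪ , ④ ∷ [] ∥ ③ , []) ∷ (① , [] ∥ ④ , ⓪ ∷ []) ∷
   (③ , [] ∥ ④ , []) ∷ []) ∷
  ((⓪ , [] ∥ ① , []) ∷ (⓪ , [] ∥ ② , []) ∷ (① , [] ∥ ② , ⓪ ∷ ③ ∷ []) ∷ (① , [] ∥ ③ , ⓪ ∷ []) ∷
   (② , ③ ∷ [] ∥ ④ , []) ∷ (③ , [] ∥ ④ , []) ∷ []) ∷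
  ((⓪ , [] ∥ ① , []) ∷ (⓪ , [] ∥ ② , ① ∷ []) ∷ (⓪ , [] ∥ ③ , ① ∷ []) ∷ (⓪ , [] ∥ ④ , ① ∷ ② ∷ []) ∷
   (① , [] ∥ ② , ⓪ ∷ ③ ∷ []) ∷ (① , [] ∥ ③ , ⓪ ∷ []) ∷ (① , [] ∥ ④ , ⓪ ∷ ② ∷ ③ ∷ []) ∷
   (③ , [] ∥ ④ , ① ∷ []) ∷ []) ∷
  []

-- A greedily chosen cover: every event takes every member of the family to a state that is at least
-- as good as one of these members, with its strands renamed.
hints : List (Fin 14 × Perm)
hints =
  (# 1 , ⓪ ∷ ② ∷ ① ∷ ③ ∷ ④ ∷ []) ∷ (# 0 , ① ∷ ⓪ ∷ ② ∷ ③ ∷ ④ ∷ []) ∷ (# 0 , ② ∷ ① ∷ ⓪ ∷ ④ ∷ ③ ∷ []) ∷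
  (# 3 , ⓪ ∷ ① ∷ ② ∷ ④ ∷ ③ ∷ []) ∷ (# 2 , ⓪ ∷ ① ∷ ② ∷ ③ ∷ ④ ∷ []) ∷ (# 3 , ① ∷ ⓪ ∷ ④ ∷ ③ ∷ ② ∷ []) ∷
  (# 0 , ④ ∷ ③ ∷ ① ∷ ② ∷ ⓪ ∷ []) ∷ (# 1 , ⓪ ∷ ① ∷ ② ∷ ③ ∷ ④ ∷ []) ∷ (# 0 , ⓪ ∷ ① ∷ ② ∷ ③ ∷ ④ ∷ []) ∷
  (# 5 , ⓪ ∷ ① ∷ ② ∷ ③ ∷ ④ ∷ []) ∷ (# 4 , ⓪ ∷ ① ∷ ② ∷ ③ ∷ ④ ∷ []) ∷ (# 3 , ⓪ ∷ ① ∷ ② ∷ ③ ∷ ④ ∷ []) ∷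
  (# 1 , ③ ∷ ⓪ ∷ ① ∷ ④ ∷ ② ∷ []) ∷ (# 6 , ⓪ ∷ ① ∷ ② ∷ ③ ∷ ④ ∷ []) ∷ (# 0 , ② ∷ ⓪ ∷ ④ ∷ ① ∷ ③ ∷ []) ∷
  (# 9 , ⓪ ∷ ① ∷ ② ∷ ③ ∷ ④ ∷ []) ∷ (# 0 , ① ∷ ④ ∷ ⓪ ∷ ③ ∷ ② ∷ []) ∷ (# 8 , ⓪ ∷ ① ∷ ② ∷ ③ ∷ ④ ∷ []) ∷
  (# 7 , ⓪ ∷ ① ∷ ② ∷ ③ ∷ ④ ∷ []) ∷ (# 12 , ⓪ ∷ ① ∷ ② ∷ ③ ∷ ④ ∷ []) ∷ (# 13 , ⓪ ∷ ① ∷ ② ∷ ③ ∷ ④ ∷ []) ∷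
  (# 11 , ⓪ ∷ ① ∷ ② ∷ ③ ∷ ④ ∷ []) ∷ (# 0 , ③ ∷ ⓪ ∷ ② ∷ ① ∷ ④ ∷ []) ∷ (# 10 , ⓪ ∷ ① ∷ ② ∷ ③ ∷ ④ ∷ []) ∷
  (# 0 , ② ∷ ⓪ ∷ ③ ∷ ① ∷ ④ ∷ []) ∷ (# 3 , ① ∷ ③ ∷ ② ∷ ⓪ ∷ ④ ∷ []) ∷ (# 3 , ⓪ ∷ ① ∷ ③ ∷ ④ ∷ ② ∷ []) ∷
  (# 0 , ① ∷ ⓪ ∷ ③ ∷ ② ∷ ④ ∷ []) ∷ (# 0 , ③ ∷ ⓪ ∷ ① ∷ ② ∷ ④ ∷ []) ∷ (# 2 , ⓪ ∷ ② ∷ ③ ∷ ④ ∷ ① ∷ []) ∷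
  (# 6 , ① ∷ ② ∷ ④ ∷ ⓪ ∷ ③ ∷ []) ∷ (# 4 , ① ∷ ⓪ ∷ ③ ∷ ② ∷ ④ ∷ []) ∷ (# 1 , ⓪ ∷ ① ∷ ② ∷ ④ ∷ ③ ∷ []) ∷
  (# 4 , ⓪ ∷ ① ∷ ③ ∷ ② ∷ ④ ∷ []) ∷ (# 10 , ② ∷ ⓪ ∷ ④ ∷ ① ∷ ③ ∷ []) ∷ (# 2 , ① ∷ ③ ∷ ② ∷ ④ ∷ ⓪ ∷ []) ∷
  (# 6 , ② ∷ ⓪ ∷ ③ ∷ ① ∷ ④ ∷ []) ∷ (# 3 , ④ ∷ ① ∷ ② ∷ ③ ∷ ⓪ ∷ []) ∷ (# 0 , ④ ∷ ⓪ ∷ ② ∷ ① ∷ ③ ∷ []) ∷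
  (# 6 , ① ∷ ⓪ ∷ ③ ∷ ② ∷ ④ ∷ []) ∷ (# 6 , ② ∷ ④ ∷ ⓪ ∷ ③ ∷ ① ∷ []) ∷ (# 7 , ⓪ ∷ ① ∷ ② ∷ ④ ∷ ③ ∷ []) ∷
  (# 6 , ① ∷ ⓪ ∷ ④ ∷ ② ∷ ③ ∷ []) ∷ (# 0 , ⓪ ∷ ② ∷ ③ ∷ ④ ∷ ① ∷ []) ∷ (# 1 , ① ∷ ⓪ ∷ ④ ∷ ② ∷ ③ ∷ []) ∷
  (# 3 , ① ∷ ⓪ ∷ ② ∷ ④ ∷ ③ ∷ []) ∷ (# 4 , ① ∷ ⓪ ∷ ② ∷ ③ ∷ ④ ∷ []) ∷ (# 1 , ⓪ ∷ ② ∷ ① ∷ ④ ∷ ③ ∷ []) ∷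
  (# 0 , ⓪ ∷ ① ∷ ② ∷ ④ ∷ ③ ∷ []) ∷ (# 1 , ① ∷ ⓪ ∷ ③ ∷ ④ ∷ ② ∷ []) ∷ (# 4 , ① ∷ ③ ∷ ② ∷ ④ ∷ ⓪ ∷ []) ∷
  (# 11 , ② ∷ ④ ∷ ⓪ ∷ ① ∷ ③ ∷ []) ∷ (# 1 , ⓪ ∷ ③ ∷ ② ∷ ④ ∷ ① ∷ []) ∷ (# 3 , ⓪ ∷ ② ∷ ④ ∷ ③ ∷ ① ∷ []) ∷
  (# 6 , ⓪ ∷ ② ∷ ③ ∷ ④ ∷ ① ∷ []) ∷ (# 11 , ⓪ ∷ ② ∷ ③ ∷ ④ ∷ ① ∷ []) ∷ (# 12 , ④ ∷ ③ ∷ ① ∷ ⓪ ∷ ② ∷ []) ∷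
  (# 0 , ④ ∷ ② ∷ ③ ∷ ⓪ ∷ ① ∷ []) ∷ (# 1 , ② ∷ ⓪ ∷ ④ ∷ ③ ∷ ① ∷ []) ∷ (# 0 , ③ ∷ ② ∷ ④ ∷ ⓪ ∷ ① ∷ []) ∷
  (# 0 , ④ ∷ ⓪ ∷ ① ∷ ② ∷ ③ ∷ []) ∷
  []

-- Verification of the closed family by evaluation

_==_ : Strand → Strand → Bool
⓪ == ⓪ = true
① == ① = true
② == ② = true
③ == ③ = true
④ == ④ = true
_ == _ = false

==⇒≡ : ∀ i j → T (i == j) → i ≡ j
==⇒≡ = from-yes (allFin? λ i → allFin? λ j → T? (i == j) →-dec (i ≟ j))

_⊆ᵇ_ : List Strand → List Strand → Bool
ks ⊆ᵇ ls = all (λ k → any (k ==_) ls) ks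

_≼ᵇ_ : Config → Config → Bool
((i , s) , (j , t)) ≼ᵇ ((i′ , s′) , (j′ , t′)) = (i == i′) ∧ (j == j′) ∧ (s ⊆ᵇ s′) ∧ (t ⊆ᵇ t′)

coversᵇ : List Config → Config → Bool
coversᵇ ds c = any (λ d → (d ≼ᵇ c) ∨ (d ≼ᵇ swap c)) ds

⊆ᵇ⇒⊆ : ∀ ks ls → T (ks ⊆ᵇ ls) → All (_∈ ls) ks
⊆ᵇ⇒⊆ ks ls t = All.map (λ t′ → Any.map (==⇒≡ _ _) (any⁻ _ ls t′)) (all⁺ _ ks t)

≼ᵇ⇒≼ : ∀ c d → T (c ≼ᵇ d) → c ≼ d
≼ᵇ⇒≼ ((i , s) , (j , t)) ((i′ , s′) , (j′ , t′)) h =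
  let h₁ , h′ = Equivalence.to T-∧ h
      h₂ , h″ = Equivalence.to T-∧ h′
      h₃ , h₄ = Equivalence.to T-∧ h″
  in ==⇒≡ i i′ h₁ , ==⇒≡ j j′ h₂ , ⊆ᵇ⇒⊆ s s′ h₃ , ⊆ᵇ⇒⊆ t t′ h₄

-- The two paths are interchangeable, so a configuration may be matched in either order of its
-- positions.
Covers : List Config → Config → Set
Covers ds c = Any (λ d → d ≼ c ⊎ d ≼ swap c) ds

coversᵇ⇒Covers : ∀ ds c → T (coversᵇ ds c) → Covers ds c
coversᵇ⇒Covers ds c t = Any.map (Sum.map (≼ᵇ⇒≼ _ _) (≼ᵇ⇒≼ _ _) ∘ Equivalence.to T-∨) (any⁻ _ ds t)

Injective : Perm → Set
Injective π = ∀ i j → lookup π i ≡ lookup π j → i ≡ j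

Permitted : Event → Set
Permitted (turn σ) = Injective σ
Permitted _        = ⊤

-- `closed` is made for carrying solutions backwards over an event: whichever configuration of
-- `state s′` is solved behind it, the renamed configuration is matched by a successor of some
-- configuration of `state s`, which is thereby solved in front of it.
record ClosedFamily : Set where
  field
    {size}   : ℕ
    state    : Fin size → State
    nonempty : ∀ s → ∃ λ c → c ∈ state s
    closed   : ∀ s {e} → Permitted e → ∃₂ λ s′ π → Injective π ×
               All (Covers (concatMap (successors e) (state s)) ∘ rename π) (state s′)

-- The data are variables here, so the soundness proof does not evaluate them; the test runs only
-- where `closed` is applied to the actual family.
module Closure {N} (family : Vec State N) (events : List Event) (hints : List (Fin N × Perm)) where

  landsᵇ : List Config → Fin N × Perm → Bool
  landsᵇ ds (s , π) = all (coversᵇ ds ∘ rename π) (lookup family s)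

  stepsᵇ : State → Event → Bool
  stepsᵇ S e = any (landsᵇ (concatMap (successors e) S)) hints

  closedᵇ : Fin N → Bool
  closedᵇ s = all (stepsᵇ (lookup family s)) events

  closed : T (all closedᵇ (allFin N)) → ∀ s {e} → e ∈ events →
           ∃ λ (s′ , π) → (s′ , π) ∈ hints ×
           All (Covers (concatMap (successors e) (lookup family s)) ∘ rename π) (lookup family s′)
  closed t s {e} e∈ =
    let t₁ = All.lookup (all⁺ closedᵇ (allFin N) t) (∈-allFin s)
        t₂ = All.lookup (all⁺ (stepsᵇ (lookup family s)) events t₁) e∈
        (s′ , π) , h∈ , t₃ = find (any⁻ (landsᵇ (concatMap (successors e) (lookup family s))) hints t₂)
    in (s′ , π) , h∈ ,
       All.map (λ {c} → coversᵇ⇒Covers (concatMap (successors e) (lookup family s)) (rename π c))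
         (all⁺ (coversᵇ (concatMap (successors e) (lookup family s)) ∘ rename π) (lookup family s′) t₃)

hints-injective : All (Injective ∘ proj₂) hints
hints-injective = from-yes (all? (λ (_ , π) → allFin? λ i → allFin? λ j →
  (lookup π i ≟ lookup π j) →-dec (i ≟ j)) hints)

family-nonempty : ∀ s → ∃ λ c → c ∈ lookup family s
family-nonempty s = nonempty (lookup family s) (from-yes (allFin? λ s → ¬? (T? (null (lookup family s)))) s)
  where
  nonempty : ∀ S → ¬ T (null S) → ∃ λ c → c ∈ S
  nonempty []      ¬n with () ← ¬n tt
  nonempty (c ∷ _) _  = c , here refl

∈-successors⁻ : ∀ {e c d} → d ∈ successors e c → ∃ λ ms → Admissible e c ms × d ≡ target e c ms
∈-successors⁻ {e} {c} d∈ =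
  let ms , ms∈ , eq = ∈-map⁻ (target e c) d∈
  in ms , proj₂ (∈-filter⁻ (admissible? e c) {xs = cartesianProduct moves moves} ms∈) , eq

∈-injections : ∀ {l} (v : Vec Strand l) → (∀ i j → lookup v i ≡ lookup v j → i ≡ j) → v ∈ injections l
∈-injections []      _   = here refl
∈-injections (k ∷ v) inj =
  ∈-concatMap⁺ _ (Any.map (λ { refl → ∈-map⁺ (_∷ v) (∈-filter⁺ (λ k′ → ¬? (k′ ∈? toListᵛ v)) (∈-allFin k) fresh) })
    (∈-injections v λ i j eq → suc-injective (inj (suc i) (suc j) eq)))
  where
  position : ∀ {l} (w : Vec Strand l) → k ∈ toListᵛ w → ∃ λ i → k ≡ lookup w i
  position (x ∷ w) (here eq) = zero , eq
  position (x ∷ w) (there p) with position w p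
  ... | i , eq = suc i , eq

  fresh : k ∉ toListᵛ v
  fresh k∈ with position v k∈
  ... | i , eq with () ← inj zero (suc i) eq

skip∈events : ∀ k → skip k ∈ events
skip∈events k = ∈-++⁺ˡ (∈-map⁺ skip (∈-allFin k))

meet∈events : ∀ k l → meet k l ∈ events
meet∈events k l = ∈-++⁺ʳ (map skip (allFin 5)) (∈-++⁺ˡ
  (∈-map⁺ (λ (k , l) → meet k l) (∈-cartesianProduct⁺ (∈-allFin k) (∈-allFin l))))

turn∈events : ∀ σ → Injective σ → turn σ ∈ events
turn∈events σ inj = ∈-++⁺ʳ (map skip (allFin 5)) (∈-++⁺ʳ
  (map (λ (k , l) → meet k l) (cartesianProduct (allFin 5) (allFin 5))) (∈-map⁺ turn (∈-injections σ inj)))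

permitted∈events : ∀ {e} → Permitted e → e ∈ events
permitted∈events {skip k}   _   = skip∈events k
permitted∈events {meet k l} _   = meet∈events k l
permitted∈events {turn σ}   inj = turn∈events σ inj

closedFamily : ClosedFamily
closedFamily = record
  { state    = lookup family
  ; nonempty = family-nonempty
  ; closed   = λ s {e} permitted →
      let (s′ , π) , h∈ , covered = Closure.closed family events hints _ s {e} (permitted∈events permitted)
      in s′ , π , All.lookup hints-injective h∈ , covered
  }

-- Linkages

module Linkages {n} (G : Graph n) (Y : VSet n) where

  -- Strands may be empty: the paths starting there are empty and regarded as having arrived in Y.
  Linkage : Set
  Linkage = Strand → List (Fin n)

  _on_ : Fin n → Linkage → Set
  v on L = ∃ λ i → v ∈ L i

  Link : Linkage → Fin n → Fin n → Set
  Link L u v = ∃ λ i → Consec (L i) u v ⊎ Consec (L i) v u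

  -- `few` looks only at neighbours on `L`. Otherwise validity would be lost on shortening a strand,
  -- because the edge from a removed vertex to the new tip is no longer a link.
  record Valid (L : Linkage) : Set where
    field
      unique   : ∀ i → Unique (L i)
      disjoint : ∀ {i j v} → v ∈ L i → v ∈ L j → i ≡ j
      route    : ∀ i → Route G Y (L i)
      few      : ∀ {v w w′} → v on L → w on L → w′ on L →
                 Adj G v w → ¬ Link L v w → Adj G v w′ → ¬ Link L v w′ → w ≡ w′

  record Cut (L R : Linkage) : Set where
    field
      prefix : Strand → List (Fin n)
      split  : ∀ i → L i ≡ prefix i ++ R i

  Apart : List (Fin n) → List (Fin n) → Set
  Apart A B = ∀ {u v} → u ∈ A → v ∈ B → u ≢ v × ¬ Adj G u v

  record Half (L : Linkage) (i : Strand) (banned : List Strand) (A : List (Fin n)) : Set where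
    field
      starts   : head A ≡ head (L i)
      isRoute  : Route G Y A
      isUnique : Unique A
      inside   : ∀ {v} → v ∈ A → v on L
      avoids   : ∀ {k v} → k ∈ banned → head (L k) ≡ just v → v ∉ A

  Solution : Linkage → Config → Set
  Solution L ((i , s) , (j , t)) = ∃₂ λ A B → Half L i t A × Half L j s B × Apart A B

  -- A₀ leads from the tip of L i to the tip of R i′. Its only neighbours on R are this tip and the
  -- tips of the trail.
  record Piece (L R : Linkage) (i i′ : Strand) (tips trail : List Strand) (A₀ : List (Fin n)) : Set where
    field
      splice-route : ∀ {A} → head A ≡ head (R i′) → Route G Y A → Route G Y (A₀ ++ A)
      splice-head  : ∀ {A} → head A ≡ head (R i′) → head (A₀ ++ A) ≡ head (L i)
      lead-unique  : Unique A₀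
      before       : ∀ {v} → v ∈ A₀ → v on L × ¬ v on R
      touches      : ∀ {u v} → u ∈ A₀ → v on R → Adj G u v →
                     ∃ λ k → head (R k) ≡ just v × (k ≡ i′ ⊎ k ∈ trail)
      enters       : ∀ {k v} → head (L k) ≡ just v → v ∈ A₀ → k ∈ tips

  -- The interface between the bookkeeping with strand numbers and the graph: what `Admissible` and
  -- `target` presume about an event is backed here by actual initial segments of paths.
  record Realises (e : Event) (L R : Linkage) : Set where
    field
      within    : ∀ {v} → v on R → v on L
      consumed  : ∀ {k v} → Touched e k → head (L k) ≡ just v → ¬ v on R
      untouched≡ : ∀ {k} → ¬ Touched e k → R k ≡ L k
      lead      : Move → Strand → List (Fin n)
      isPiece   : ∀ m {i} → Legal e m i → Piece L R i (exit e m i) (tips e m i) (trail e m i) (lead m i)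
      apart     : ∀ m m′ {i j} → Legal e m i → Legal e m′ j → Compatible e m i m′ j →
                  Apart (lead m i) (lead m′ j)

  link? : ∀ (L : Linkage) u v → Dec (Link L u v)
  link? L u v = anyFin? λ i → consec? _≟_ (L i) u v ⊎-dec consec? _≟_ (L i) v u

  apart-sym : ∀ {A B} → Apart A B → Apart B A
  apart-sym ap u∈ v∈ = let ne , na = ap v∈ u∈ in ne ∘ ≡-sym , na ∘ adj-sym {G = G}

  module _ {L : Linkage} (valid : Valid L) where
    open Valid valid

    neighbour : ∀ {v m w} → v on L → m on L → Adj G v m → ¬ Link L v m →
                w on L → Adj G v w → w ≡ m ⊎ Link L v w
    neighbour {v} {m} {w} v∈ m∈ vm ¬l w∈ vw with link? L v w
    ... | yes l = inj₂ l
    ... | no ¬l′ = inj₁ (few v∈ w∈ m∈ vw ¬l′ vm ¬l)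

    link-strand : ∀ {i u v} → u ∈ L i → Link L u v → Consec (L i) u v ⊎ Consec (L i) v u
    link-strand u∈ (j , inj₁ c) with disjoint u∈ (consec-∈ˡ c)
    ... | refl = inj₁ c
    link-strand u∈ (j , inj₂ c) with disjoint u∈ (consec-∈ʳ c)
    ... | refl = inj₂ c

    link-tip : ∀ {i p vs v} → L i ≡ p ∷ vs → Link L p v → head vs ≡ just v
    link-tip {i} {p} {vs} eq l
      with link-strand {i} (subst (p ∈_) (≡-sym eq) (here refl)) l | subst Unique eq (unique i)
    ... | c | u rewrite eq with c
    ... | inj₂ c′ = contradiction c′ (consec-¬head u refl)
    ... | inj₁ c′ with consec-∷⁻ c′
    ...   | inj₁ (_ , h) = h
    ...   | inj₂ c″ = contradiction (consec-∈ˡ c″) (unique-∷ u)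

    module _ {R : Linkage} (cut : Cut L R) where
      open Cut cut

      cut-∈ : ∀ {i v} → v ∈ R i → v ∈ L i
      cut-∈ {i} v∈ = subst (_ ∈_) (≡-sym (split i)) (∈-++⁺ʳ (prefix i) v∈)

      cut-on : ∀ {v} → v on R → v on L
      cut-on (i , v∈) = i , cut-∈ v∈

      cut-unique : ∀ i → Unique (prefix i ++ R i)
      cut-unique i = subst Unique (split i) (unique i)

      cut-on-∈ : ∀ {i v} → v ∈ L i → v on R → v ∈ R i
      cut-on-∈ v∈ (j , v∈′) with disjoint v∈ (cut-∈ v∈′)
      ... | refl = v∈′

      -- By disjointness the link is an edge of strand `i`, and a single edge of that strand leads
      -- from the removed part to the rest.
      cut-link : ∀ {i u v} → u ∈ L i → ¬ u on R → v on R →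
                 Link L u v → head (R i) ≡ just v
      cut-link {i} {u} {v} u∈ u∉ v-on l with link-strand u∈ l
      ... | inj₁ c with ∈-++⁻ (prefix i) (subst (u ∈_) (split i) u∈)
      ...   | inj₁ u∈p = consec-boundary (prefix i) (cut-unique i) (subst (λ xs → Consec xs u v) (split i) c)
                           u∈p (cut-on-∈ (consec-∈ʳ c) v-on)
      ...   | inj₂ u∈R = contradiction (i , u∈R) u∉
      cut-link {i} {u} {v} u∈ u∉ v-on l | inj₂ c = contradiction (i , consec-∈ʳ
        (consec-suffix (prefix i) (cut-unique i) (subst (λ xs → Consec xs v u) (split i) c)
          (cut-on-∈ (consec-∈ˡ c) v-on))) u∉

      -- Linked vertices that both remain are still linked in `R`, so shortening creates no extra
      -- edges between remaining vertices.
      cut-valid : Valid R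
      cut-valid = record
        { unique   = λ i → unique-suffix (prefix i) (cut-unique i)
        ; disjoint = λ v∈ v∈′ → disjoint (cut-∈ v∈) (cut-∈ v∈′)
        ; route    = λ i → route-suffix (prefix i) (subst (Route G Y) (split i) (route i))
        ; few      = λ v∈ w∈ w′∈ vw ¬l vw′ ¬l′ →
            few (cut-on v∈) (cut-on w∈) (cut-on w′∈) vw (¬l ∘ restrict v∈ w∈) vw′ (¬l′ ∘ restrict v∈ w′∈)
        }
        where
        restrict : ∀ {u v} → u on R → v on R → Link L u v → Link R u v
        restrict u∈ v∈ (i , inj₁ c) = i , inj₁ (consec-suffix (prefix i) (cut-unique i)
          (subst (λ xs → Consec xs _ _) (split i) c) (cut-on-∈ (consec-∈ˡ c) u∈))
        restrict u∈ v∈ (i , inj₂ c) = i , inj₂ (consec-suffix (prefix i) (cut-unique i)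
          (subst (λ xs → Consec xs _ _) (split i) c) (cut-on-∈ (consec-∈ˡ c) v∈))

    rename-valid : ∀ {π} → Injective π → Valid (L ∘ lookup π)
    rename-valid {π} inj = record
      { unique   = λ i → unique (lookup π i)
      ; disjoint = λ v∈ v∈′ → inj _ _ (disjoint v∈ v∈′)
      ; route    = λ i → route (lookup π i)
      ; few      = λ v∈ w∈ w′∈ vw ¬l vw′ ¬l′ →
          few (forget v∈) (forget w∈) (forget w′∈) vw (¬l ∘ restrict v∈) vw′ (¬l′ ∘ restrict v∈)
      }
      where
      forget : ∀ {v} → v on (L ∘ lookup π) → v on L
      forget (i , v∈) = lookup π i , v∈

      restrict : ∀ {u v} → u on (L ∘ lookup π) → Link L u v → Link (L ∘ lookup π) u v
      restrict (i , u∈) l = i , link-strand u∈ l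

  half-weaken : ∀ {L i s t A} → All (_∈ t) s → Half L i t A → Half L i s A
  half-weaken sub h = record
    { starts = starts ; isRoute = isRoute ; isUnique = isUnique ; inside = inside
    ; avoids = λ k∈ → avoids (All.lookup sub k∈) }
    where open Half h

  solution-weaken : ∀ {L c d} → d ≼ c → Solution L c → Solution L d
  solution-weaken (refl , refl , s⊆ , t⊆) (A , B , hA , hB , ap) =
    A , B , half-weaken t⊆ hA , half-weaken s⊆ hB , ap

  solution-swap : ∀ {L c} → Solution L (swap c) → Solution L c
  solution-swap (A , B , hA , hB , ap) = B , A , hB , hA , apart-sym ap

  half-rename : ∀ {L i t A} π → Half (L ∘ lookup π) i t A →
                Half L (lookup π i) (map (lookup π) t) A
  half-rename {L} {i} {t} {A} π h = record
    { starts = starts ; isRoute = isRoute ; isUnique = isUnique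
    ; inside = λ v∈ → let k , v∈′ = inside v∈ in lookup π k , v∈′
    ; avoids = λ k∈ → avoids′ (∈-map⁻ (lookup π) k∈)
    }
    where
    open Half h
    avoids′ : ∀ {k v} → (∃ λ k′ → k′ ∈ t × k ≡ lookup π k′) → head (L k) ≡ just v → v ∉ A
    avoids′ (k′ , k′∈ , refl) = avoids k′∈

  solution-rename : ∀ {L c} π → Solution (L ∘ lookup π) c → Solution L (rename π c)
  solution-rename π (A , B , hA , hB , ap) = A , B , half-rename π hA , half-rename π hB , ap

  module _ {e : Event} {L R : Linkage} (realises : Realises e L R) where
    open Realises realises

    half-extend : ∀ {m i tr t A} → Legal e m i → All (_∉ t) (tips e m i) →
                  Half R (exit e m i) (tr ++ untouched e t) A → Half L i t (lead m i ++ A)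
    half-extend {m} {i} {tr = tr} {t} {A} legal tips∉ h = record
      { starts   = splice-head starts
      ; isRoute  = splice-route starts isRoute
      ; isUnique = Unique.++⁺ lead-unique isUnique (λ (v∈ , v∈′) → proj₂ (before v∈) (inside v∈′))
      ; inside   = λ v∈ → Sum.[ proj₁ ∘ before , within ∘ inside ] (∈-++⁻ (lead m i) v∈)
      ; avoids   = avoids′
      }
      where
      open Half h
      open Piece (isPiece m legal)

      avoids′ : ∀ {k v} → k ∈ t → head (L k) ≡ just v → v ∉ lead m i ++ A
      avoids′ {k} k∈ hd v∈ with ∈-++⁻ (lead m i) v∈
      ... | inj₁ v∈₀ = All.lookup tips∉ (enters hd v∈₀) k∈
      -- On a touched strand the forbidden tip has left the linkage. On an untouched one it is still
      -- the tip, and the ban has survived in `untouched e t`.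
      ... | inj₂ v∈A with touched? e k
      ...   | yes τ = consumed τ hd (inside v∈A)
      ...   | no ¬τ = avoids (∈-++⁺ʳ tr (∈-filter⁺ (λ k → ¬? (touched? e k)) k∈ ¬τ))
                        (trans (cong head (untouched≡ ¬τ)) hd) v∈A

    -- The lead sees only two kinds of vertices of `R`: the first vertex of `A`, from which `B` is
    -- apart, and the tips of the trail, which `B` has to avoid.
    lead-apart : ∀ {m i s tr A B} → (legal : Legal e m i) →
                 Half R (exit e m i) s A → (∀ {k v} → k ∈ trail e m i ++ tr → head (R k) ≡ just v → v ∉ B) →
                 (∀ {v} → v ∈ B → v on R) → Apart A B → Apart (lead m i) B
    lead-apart {m} {B = B} legal hA avoidsB insideB ap {u} {v} u∈ v∈ =
      (λ { refl → proj₂ (before u∈) (insideB v∈) }) , ¬adj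
      where
      open Piece (isPiece m legal)
      ¬adj : ¬ Adj G u v
      ¬adj uv with touches u∈ (insideB v∈) uv
      ... | k , hd , inj₁ refl = proj₁ (ap (head-∈ (trans (Half.starts hA) hd)) v∈) refl
      ... | k , hd , inj₂ k∈   = avoidsB (∈-++⁺ˡ k∈) hd v∈

    solution-extend : ∀ {c ms} → Admissible e c ms → Solution R (target e c ms) → Solution L c
    solution-extend {(i , s) , (j , t)} {m , m′} (lm , lm′ , cp , tips∉ , tips∉′) (A , B , hA , hB , ap) =
      lead m i ++ A , lead m′ j ++ B , half-extend lm tips∉ hA , half-extend lm′ tips∉′ hB , ap′
      where
      ap′ : Apart (lead m i ++ A) (lead m′ j ++ B)
      ap′ u∈ v∈ with ∈-++⁻ (lead m i) u∈ | ∈-++⁻ (lead m′ j) v∈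
      ... | inj₁ u∈₀ | inj₁ v∈₀ = apart m m′ lm lm′ cp u∈₀ v∈₀
      ... | inj₁ u∈₀ | inj₂ v∈B = lead-apart lm hA (Half.avoids hB) (Half.inside hB) ap u∈₀ v∈B
      ... | inj₂ u∈A | inj₁ v∈₀ =
        apart-sym (lead-apart lm′ hB (Half.avoids hA) (Half.inside hA) (apart-sym ap)) u∈A v∈₀
      ... | inj₂ u∈A | inj₂ v∈B = ap u∈A v∈B

-- Skips and meetings in a linkage

module Realisations {n} (G : Graph n) (Y : VSet n) where
  open Linkages G Y

  Closed : Linkage → Linkage → Fin n → Set
  Closed L R u = ∀ {v} → v on R → Adj G u v → Link L u v

  idle-piece : ∀ {L R i} → R i ≡ L i → Piece L R i i [] [] []
  idle-piece eq = record
    { splice-route = λ _ r → r ; splice-head = λ h → trans h (cong head eq) ; lead-unique = []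
    ; before = λ () ; touches = λ () ; enters = λ _ () }

  module _ {L R : Linkage} (valid : Valid L) (cut : Cut L R) where
    open Valid valid

    at-tip : ∀ {i p vs} → L i ≡ p ∷ vs → p ∈ L i
    at-tip eq = subst (_ ∈_) (≡-sym eq) (here refl)

    dropped : ∀ {i v} us → L i ≡ us ++ R i → v ∈ us → ¬ v on R
    dropped {i} us eq v∈ v-on = unique-++ us (subst Unique eq (unique i)) v∈
      (cut-on-∈ valid cut (subst (_ ∈_) (≡-sym eq) (∈-++⁺ˡ v∈)) v-on)

    only-tip : ∀ {i k p vs v} → L i ≡ p ∷ vs → head (L k) ≡ just v → v ∈ L i → k ≡ i × v ≡ p
    only-tip eq hd v∈ with disjoint (head-∈ hd) v∈
    ... | refl = refl , just-injective (trans (≡-sym hd) (cong head eq))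

    advance-piece : ∀ {i p} → L i ≡ p ∷ R i → Closed L R p → Piece L R i i (i ∷ []) [] (p ∷ [])
    advance-piece {i} {p} eq cl = record
      { splice-route = λ h → route-graft (subst (Route G Y) eq (route i)) h
      ; splice-head  = λ _ → cong head (≡-sym eq)
      ; lead-unique  = [] ∷ []
      ; before       = λ { (here refl) → (i , at-tip eq) , dropped (p ∷ []) eq (here refl) }
      ; touches      = λ { (here refl) v-on pv → i ,
          cut-link valid cut (at-tip eq) (dropped (p ∷ []) eq (here refl)) v-on (cl v-on pv) , inj₁ refl }
      ; enters       = λ { hd (here refl) → here (proj₁ (only-tip eq hd (at-tip eq))) }
      }

    meet-piece : ∀ {i j p r ts} → L i ≡ p ∷ R i → L j ≡ r ∷ R j → i ∈ ts → j ∈ ts → Adj G p r →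
                 Closed L R p → Closed L R r → Piece L R i j ts (i ∷ []) (p ∷ r ∷ [])
    meet-piece {i} {j} {p} {r} eq eq′ i∈ j∈ pr cl cl′ = record
      { splice-route = λ h rt → pr ∷ route-graft (subst (Route G Y) eq′ (route j)) h rt
      ; splice-head  = λ _ → cong head (≡-sym eq)
      ; lead-unique  = ((λ { refl → adj-irrefl {G = G} pr }) ∷ []) ∷ [] ∷ []
      ; before       = λ { (here refl)         → (i , at-tip eq) , dropped (p ∷ []) eq (here refl)
                         ; (there (here refl)) → (j , at-tip eq′) , dropped (r ∷ []) eq′ (here refl) }
      ; touches      = λ { (here refl) v-on pv → i ,
            cut-link valid cut (at-tip eq) (dropped (p ∷ []) eq (here refl)) v-on (cl v-on pv) , inj₂ (here refl)
                         ; (there (here refl)) v-on rv → j ,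
            cut-link valid cut (at-tip eq′) (dropped (r ∷ []) eq′ (here refl)) v-on (cl′ v-on rv) , inj₁ refl }
      ; enters       = λ { hd (here refl)         → subst (_∈ _) (≡-sym (proj₁ (only-tip eq hd (at-tip eq)))) i∈
                         ; hd (there (here refl)) → subst (_∈ _) (≡-sym (proj₁ (only-tip eq′ hd (at-tip eq′)))) j∈ }
      }

    skip-realises : ∀ {k p} → L k ≡ p ∷ R k → (∀ {i} → i ≢ k → R i ≡ L i) → Closed L R p →
                    Realises (skip k) L R
    skip-realises {k} {p} eq same cl = record
      { within     = cut-on valid cut
      ; consumed   = λ { refl hd → subst (λ v → ¬ v on R)
          (just-injective (trans (cong head (≡-sym eq)) hd)) (dropped (p ∷ []) eq (here refl)) }
      ; untouched≡ = same
      ; lead       = λ { stay _ → p ∷ [] ; _ _ → [] }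
      ; isPiece    = λ { idle ¬τ → idle-piece (same ¬τ) ; stay refl → advance-piece eq cl ; cross () }
      ; apart      = λ { idle  _ _ _ _ () ; stay idle _ _ _ _ () ; stay stay _ _ () ; stay cross _ _ ()
                       ; cross _ () }
      }

    meet-realises : ∀ {k l p r} → k ≢ l → L k ≡ p ∷ R k → L l ≡ r ∷ R l →
                    (∀ {i} → i ≢ k → i ≢ l → R i ≡ L i) → Adj G p r →
                    Closed L R p → Closed L R r → Realises (meet k l) L R
    meet-realises {k} {l} {p} {r} k≢l eq eq′ same pr cl cl′ = record
      { within     = cut-on valid cut
      ; consumed   = λ { (inj₁ refl) hd → gone eq hd ; (inj₂ refl) hd → gone eq′ hd }
      ; untouched≡ = λ ¬τ → same (¬τ ∘ inj₁) (¬τ ∘ inj₂)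
      ; lead       = lead
      ; isPiece    = isPiece
      ; apart      = λ { idle _ _ _ _ () ; stay idle _ _ _ _ () ; stay stay _ _ () ; stay cross _ _ ()
                       ; cross idle _ _ _ _ () ; cross stay _ _ () ; cross cross _ _ () }
      }
      where
      gone : ∀ {i w v} → L i ≡ w ∷ R i → head (L i) ≡ just v → ¬ v on R
      gone {w = w} eq₁ hd = subst (λ v → ¬ v on R) (just-injective (trans (cong head (≡-sym eq₁)) hd))
        (dropped (w ∷ []) eq₁ (here refl))

      lead : Move → Strand → List (Fin n)
      lead idle  _ = []
      lead stay  i with i ≟ k
      ... | yes _ = p ∷ []
      ... | no  _ = r ∷ []
      lead cross i with i ≟ k
      ... | yes _ = p ∷ r ∷ []
      ... | no  _ = r ∷ p ∷ []

      isPiece : ∀ m {i} → Legal (meet k l) m i →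
                Piece L R i (exit (meet k l) m i) (tips (meet k l) m i) (trail (meet k l) m i) (lead m i)
      isPiece idle  ¬τ = idle-piece (same (¬τ ∘ inj₁) (¬τ ∘ inj₂))
      isPiece stay {i} τ with i ≟ k | τ
      ... | yes refl | _         = advance-piece eq cl
      ... | no i≢k   | inj₁ i≡k  = contradiction i≡k i≢k
      ... | no _     | inj₂ refl = advance-piece eq′ cl′
      isPiece cross {i} τ with i ≟ k | τ
      ... | yes refl | _         = meet-piece eq eq′ (here refl) (there (here refl)) pr cl cl′
      ... | no i≢k   | inj₁ i≡k  = contradiction i≡k i≢k
      ... | no _     | inj₂ refl = meet-piece eq′ eq (there (here refl)) (here refl) (adj-sym {G = G} pr) cl′ cl

  -- Turns in a linkage

  record Turn (L R : Linkage) (σ : Perm) : Set where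
    field
      t u       : Strand → Fin n
      injective : Injective σ
      shape     : ∀ {i} → lookup σ i ≢ i → L i ≡ t i ∷ u i ∷ R i
      same      : ∀ {i} → lookup σ i ≡ i → R i ≡ L i
      edge      : ∀ {i} → lookup σ i ≢ i → Adj G (t i) (u (lookup σ i))
      extra     : ∀ {i} → lookup σ i ≢ i → ¬ Link L (t i) (u (lookup σ i))
      preimage  : ∀ {i} → lookup σ i ≢ i → ∃ λ j → lookup σ j ≢ j × lookup σ j ≡ i

  module _ {L R : Linkage} {σ : Perm} (valid : Valid L) (cut : Cut L R) (turning : Turn L R σ) where
    open Valid valid
    open Turn turning

    private
      τ : Strand → Strand
      τ = lookup σ

      Moved : Strand → Set
      Moved i = τ i ≢ i

    moved-τ : ∀ {i} → Moved i → Moved (τ i)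
    moved-τ m eq = m (injective _ _ eq)

    t∈ : ∀ {i} → Moved i → t i ∈ L i
    t∈ m = subst (_ ∈_) (≡-sym (shape m)) (here refl)

    u∈ : ∀ {i} → Moved i → u i ∈ L i
    u∈ m = subst (_ ∈_) (≡-sym (shape m)) (there (here refl))

    t≢u : ∀ {i j} → Moved i → Moved j → t i ≢ u j
    t≢u {i} {j} m m′ eq with disjoint (t∈ m) (subst (_∈ L j) (≡-sym eq) (u∈ m′))
    ... | refl = unique-∷ (subst Unique (shape m) (unique i)) (here eq)

    u-injective : ∀ {i j} → Moved i → Moved j → u i ≡ u j → i ≡ j
    u-injective {j = j} m m′ eq = disjoint (u∈ m) (subst (_∈ L j) (≡-sym eq) (u∈ m′))

    t-gone : ∀ {i} → Moved i → ¬ t i on R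
    t-gone {i} m = dropped valid cut (t i ∷ u i ∷ []) (shape m) (here refl)

    u-gone : ∀ {i} → Moved i → ¬ u i on R
    u-gone {i} m = dropped valid cut (t i ∷ u i ∷ []) (shape m) (there (here refl))

    -- A tip has one strand edge, being first on its strand, and at most one extra edge, which is
    -- known here.
    t-neighbour : ∀ {i v} → Moved i → v on L → Adj G (t i) v → v ≡ u (τ i) ⊎ v ≡ u i
    t-neighbour {i} m v-on tv
      with neighbour valid (i , t∈ m) (τ i , u∈ (moved-τ m)) (edge m) (extra m) v-on tv
    ... | inj₁ eq = inj₁ eq
    ... | inj₂ l  = inj₂ (just-injective (≡-sym (link-tip valid (shape m) l)))

    -- The extra edge of `u i` is the one that comes from the tip of the strand sent to `i` by `σ`.
    u-neighbour : ∀ {i v} → Moved i → v on L → Adj G (u i) v → (∃ λ j → Moved j × v ≡ t j) ⊎ Link L (u i) v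
    u-neighbour {i} m v-on uv with preimage m
    ... | j , mj , refl
      with neighbour valid (i , u∈ m) (j , t∈ mj) (adj-sym {G = G} (edge mj)) (extra mj ∘ λ (k , c) → k , Sum.swap c) v-on uv
    ...   | inj₁ eq = inj₁ (j , mj , eq)
    ...   | inj₂ l  = inj₂ l

    t-closed : ∀ {i} → Moved i → ∀ {v} → v on R → ¬ Adj G (t i) v
    t-closed m v-on tv with t-neighbour m (cut-on valid cut v-on) tv
    ... | inj₁ refl = u-gone (moved-τ m) v-on
    ... | inj₂ refl = u-gone m v-on

    u-closed : ∀ {i} → Moved i → Closed L R (u i)
    u-closed m v-on uv with u-neighbour m (cut-on valid cut v-on) uv
    ... | inj₁ (j , mj , refl) = contradiction v-on (t-gone mj)
    ... | inj₂ l = l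

    u≁u : ∀ {i j} → Moved i → Moved j → ¬ Adj G (u i) (u j)
    u≁u {i} {j} m m′ uu with u-neighbour m (j , u∈ m′) uu
    ... | inj₁ (k , mk , eq) = t≢u mk m′ (≡-sym eq)
    ... | inj₂ l with disjoint {j} {i} (u∈ m′) (Sum.[ consec-∈ʳ , consec-∈ˡ ] (link-strand valid (u∈ m) l))
    ...   | refl = adj-irrefl {G = G} uu

    -- Staying and crossing differ only in the strand `j` on which the second vertex lies, so both
    -- moves are treated at once.
    turn-piece : ∀ {i j} → Moved i → j ≡ i ⊎ j ≡ τ i → Piece L R i j (i ∷ []) [] (t i ∷ u j ∷ [])
    turn-piece {i} {j} m j≡ = record
      { splice-route = λ h r → tu ∷ route-graft (route-tail (subst (Route G Y) (shape mj) (route j))) h r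
      ; splice-head  = λ _ → cong head (≡-sym (shape m))
      ; lead-unique  = (t≢u m mj ∷ []) ∷ [] ∷ []
      ; before       = λ { (here refl) → (i , t∈ m) , t-gone m
                         ; (there (here refl)) → (j , u∈ mj) , u-gone mj }
      ; touches      = λ { (here refl) v-on tv → contradiction tv (t-closed m v-on)
                         ; (there (here refl)) v-on uv → j ,
                             cut-link valid cut (u∈ mj) (u-gone mj) v-on (u-closed mj v-on uv) , inj₁ refl }
      ; enters       = λ { hd (here refl) → here (proj₁ (only-tip valid cut (shape m) hd (t∈ m)))
                         ; hd (there (here refl)) → contradiction
                             (≡-sym (proj₂ (only-tip valid cut (shape mj) hd (u∈ mj)))) (t≢u mj mj) }
      }
      where
      mj : Moved j
      mj = Sum.[ (λ { refl → m }) , (λ { refl → moved-τ m }) ] j≡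

      own : Adj G (t i) (u i)
      own with subst (Route G Y) (shape m) (route i)
      ... | p ∷ _ = p

      tu : Adj G (t i) (u j)
      tu = Sum.[ (λ { refl → own }) , (λ { refl → edge m }) ] j≡

    -- The paths leave on the strands `x` and `y`. Tips are adjacent only to second vertices, and
    -- second vertices are never adjacent to each other, so it is enough to exclude coincidences of
    -- strands.
    turn-apart : ∀ {i j x y} → Moved i → Moved j → Moved x → Moved y →
                 i ≢ j → y ≢ i → y ≢ τ i → x ≢ j → x ≢ τ j → x ≢ y →
                 Apart (t i ∷ u x ∷ []) (t j ∷ u y ∷ [])
    turn-apart {i} {j} {x} {y} mi mj mx my i≢j y≢i y≢τi x≢j x≢τj x≢y = λ
      { (here refl) (here refl) → (λ eq → i≢j (disjoint (t∈ mi) (subst (_∈ L j) (≡-sym eq) (t∈ mj)))) ,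
          λ tt → Sum.[ t≢u mj (moved-τ mi) , t≢u mj mi ] (t-neighbour mi (j , t∈ mj) tt)
      ; (here refl) (there (here refl)) → t≢u mi my ,
          λ tu → Sum.[ y≢τi ∘ u-injective my (moved-τ mi) , y≢i ∘ u-injective my mi ] (t-neighbour mi (y , u∈ my) tu)
      ; (there (here refl)) (here refl) → (t≢u mj mx ∘ ≡-sym) ,
          λ ut → Sum.[ x≢τj ∘ u-injective mx (moved-τ mj) , x≢j ∘ u-injective mx mj ]
                   (t-neighbour mj (x , u∈ mx) (adj-sym {G = G} ut))
      ; (there (here refl)) (there (here refl)) → x≢y ∘ u-injective mx my , u≁u mx my }

    turn-realises : Realises (turn σ) L R
    turn-realises = record
      { within     = cut-on valid cut
      ; consumed   = λ m hd → subst (λ v → ¬ v on R)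
          (just-injective (trans (cong head (≡-sym (shape m))) hd)) (t-gone m)
      ; untouched≡ = λ {k} ¬m → same (decidable-stable (τ k ≟ k) ¬m)
      ; lead       = lead
      ; isPiece    = λ { idle {i} ¬m → idle-piece (same (decidable-stable (τ i ≟ i) ¬m))
                       ; stay m → turn-piece m (inj₁ refl) ; cross m → turn-piece m (inj₂ refl) }
      ; apart      = apart
      }
      where
      lead : Move → Strand → List (Fin n)
      lead idle  _ = []
      lead stay  i = t i ∷ u i ∷ []
      lead cross i = t i ∷ u (τ i) ∷ []

      apart : ∀ m m′ {i j} → Legal (turn σ) m i → Legal (turn σ) m′ j →
              Compatible (turn σ) m i m′ j → Apart (lead m i) (lead m′ j)
      apart idle  _     _ _ _ ()
      apart stay  idle  _ _ _ _ ()
      apart cross idle  _ _ _ _ ()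
      apart stay  stay  mi mj (i≢j , τi≢j , τj≢i) =
        turn-apart mi mj mi mj i≢j (i≢j ∘ ≡-sym) (τi≢j ∘ ≡-sym) i≢j (τj≢i ∘ ≡-sym) i≢j
      apart stay  cross mi mj (i≢j , τj≢i) =
        turn-apart mi mj mi (moved-τ mj) i≢j τj≢i (i≢j ∘ ≡-sym ∘ injective _ _) i≢j (τj≢i ∘ ≡-sym) (τj≢i ∘ ≡-sym)
      apart cross stay  mi mj (i≢j , τi≢j) =
        turn-apart mi mj (moved-τ mi) mj i≢j (i≢j ∘ ≡-sym) (τi≢j ∘ ≡-sym) τi≢j (i≢j ∘ injective _ _) τi≢j
      apart cross cross mi mj (i≢j , τi≢j , τj≢i) =
        turn-apart mi mj (moved-τ mi) (moved-τ mj) i≢j τj≢i (i≢j ∘ ≡-sym ∘ injective _ _)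
          τi≢j (i≢j ∘ injective _ _) (i≢j ∘ injective _ _)

-- Finite search and periodic points of a map

search : ∀ {m} {P Q : Fin m → Set} → (∀ i → P i ⊎ Q i) → ∃ P ⊎ (∀ i → Q i)
search {zero}  f = inj₂ λ ()
search {suc m} f with f zero | search (f ∘ suc)
... | inj₁ p | _            = inj₁ (zero , p)
... | inj₂ _ | inj₁ (i , p) = inj₁ (suc i , p)
... | inj₂ q | inj₂ qs      = inj₂ λ { zero → q ; (suc i) → qs i }

module _ {A : Set} (g : A → A) where

  pow : ℕ → A → A
  pow zero    x = x
  pow (suc k) x = g (pow k x)

  pow-suc : ∀ k x → pow k (g x) ≡ g (pow k x)
  pow-suc zero    x = refl
  pow-suc (suc k) x = cong g (pow-suc k x)

  pow-+ : ∀ k l x → pow (k + l) x ≡ pow k (pow l x)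
  pow-+ zero    l x = refl
  pow-+ (suc k) l x = cong g (pow-+ k l x)

eventually-periodic : ∀ {m} (g : Fin m → Fin m) x → ∃₂ λ k c → pow g (suc c) (pow g k x) ≡ pow g k x
eventually-periodic {m} g x
  with i , j , i<j , eq ← pigeonhole (n<1+n m) (λ i → pow g (toℕ i) x)
  -- Two of the first `suc m` iterates coincide. Counting `c` from the successor of the smaller
  -- index makes the period `suc c` positive.
  with c , refl′ ← m≤n⇒∃[o]m+o≡n i<j
  = toℕ i , c , trans (≡-sym (pow-+ g (suc c) (toℕ i) x))
      (trans (cong (λ l → pow g l x) (trans (cong suc (+-comm c (toℕ i))) refl′)) (≡-sym eq))

-- Descent

module Descent {n} (G : Graph n) (Y : VSet n) (𝓕 : ClosedFamily) where
  open Linkages G Y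
  open Realisations G Y
  open ClosedFamily 𝓕

  Smaller : Linkage → Linkage → Set
  Smaller R L = (∀ {v} → v on R → v on L) × ∃ λ v → v on L × ¬ v on R

  -- All states are treated together, because an event changes the state with which the induction
  -- goes on.
  Solvable : Linkage → Set
  Solvable L = ∀ s → ∃ λ c → c ∈ state s × Solution L c

  -- q i is the other end of the extra edge of the tip t i.
  record Rotation (L : Linkage) : Set₁ where
    field
      On       : Strand → Set
      on?      : Decidable On
      τ        : Strand → Strand
      τ-on     : ∀ {i} → On i → On (τ i)
      τ-inj    : ∀ {i j} → On i → On j → τ i ≡ τ j → i ≡ j
      preimage : ∀ {i} → On i → ∃ λ j → On j × τ j ≡ i
      inhabited : ∃ On
      t q           : Strand → Fin n
      rest mid post : Strand → List (Fin n)
      tip      : ∀ {i} → On i → L i ≡ t i ∷ rest i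
      far      : ∀ {i} → On i → rest (τ i) ≡ mid i ++ q i ∷ post i
      edge     : ∀ {i} → On i → Adj G (t i) (q i)
      extra    : ∀ {i} → On i → ¬ Link L (t i) (q i)

  -- Rerouting along a rotation

  module _ {L : Linkage} (valid : Valid L) (rotation : Rotation L) where
    open Valid valid
    open Rotation rotation

    t∈L : ∀ {i} → On i → t i ∈ L i
    t∈L o = subst (_ ∈_) (≡-sym (tip o)) (here refl)

    rest-unique : ∀ {i} → On i → Unique (t i ∷ rest i)
    rest-unique {i} o = subst Unique (tip o) (unique i)

    far-unique : ∀ {i} → On i → Unique (mid i ++ q i ∷ post i)
    far-unique o with rest-unique (τ-on o)
    ... | _ ∷ u = subst Unique (far o) u

    rest∈L : ∀ {i v} → On i → v ∈ rest i → v ∈ L i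
    rest∈L o v∈ = subst (_ ∈_) (≡-sym (tip o)) (there v∈)

    far∈ : ∀ {i v} → On i → v ∈ mid i ++ q i ∷ post i → v ∈ rest (τ i)
    far∈ o = subst (_ ∈_) (≡-sym (far o))

    tail∈ : ∀ {i v} → On i → v ∈ q i ∷ post i → v ∈ L (τ i)
    tail∈ {i} o v∈ = rest∈L (τ-on o) (far∈ o (∈-++⁺ʳ (mid i) v∈))

    q∈L : ∀ {i} → On i → q i ∈ L (τ i)
    q∈L o = tail∈ o (here refl)

    t∉rest : ∀ {i j} → On i → On j → t i ∉ rest j
    t∉rest o o′ t∈ with disjoint (t∈L o) (rest∈L o′ t∈)
    ... | refl = unique-∷ (rest-unique o) t∈

    reroute : Linkage
    reroute i with on? i
    ... | yes _ = t i ∷ q i ∷ post i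
    ... | no  _ = L i

    reroute-on : ∀ {i} → On i → reroute i ≡ t i ∷ q i ∷ post i
    reroute-on {i} o with on? i
    ... | yes _ = refl
    ... | no ¬o = contradiction o ¬o

    reroute-off : ∀ {i} → ¬ On i → reroute i ≡ L i
    reroute-off {i} ¬o with on? i
    ... | yes o = contradiction o ¬o
    ... | no  _ = refl

    reroute-head : ∀ i → head (reroute i) ≡ head (L i)
    reroute-head i with on? i
    ... | yes o = cong head (≡-sym (tip o))
    ... | no  _ = refl

    data Source (v : Fin n) (i : Strand) : Set where
      start : On i → v ≡ t i → Source v i
      later : On i → v ∈ q i ∷ post i → Source v i
      kept  : ¬ On i → v ∈ L i → Source v i

    source : ∀ {i v} → v ∈ reroute i → Source v i
    source {i} v∈ with on? i
    source (here eq)  | yes o = start o eq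
    source (there v∈) | yes o = later o v∈
    source v∈         | no ¬o = kept ¬o v∈

    later∈rest : ∀ {i v} → On i → v ∈ q i ∷ post i → v ∈ rest (τ i)
    later∈rest {i} o v∈ = far∈ o (∈-++⁺ʳ (mid i) v∈)

    reroute-within : ∀ {v} → v on reroute → v on L
    reroute-within (i , v∈) with source v∈
    ... | start o refl = i , t∈L o
    ... | later o v∈′  = τ i , tail∈ o v∈′
    ... | kept _ v∈′  = i , v∈′

    -- No tail contains a tip, tails of different strands lie on different old strands as `τ` is
    -- injective, and strands off the rotation are not entered because `τ` preserves `On`.
    reroute-disjoint : ∀ {i j v} → v ∈ reroute i → v ∈ reroute j → i ≡ j
    reroute-disjoint {i} {j} v∈ v∈′ with source v∈ | source v∈′
    ... | start o refl | start o′ eq   = disjoint (t∈L o) (subst (_∈ L j) (≡-sym eq) (t∈L o′))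
    ... | start o refl | later o′ m    = contradiction (later∈rest o′ m) (t∉rest o (τ-on o′))
    ... | later o m    | start o′ refl = contradiction (later∈rest o m) (t∉rest o′ (τ-on o))
    ... | later o m    | later o′ m′   = τ-inj o o′ (disjoint (tail∈ o m) (tail∈ o′ m′))
    ... | kept _ m    | kept _ m′    = disjoint m m′
    ... | start o refl | kept ¬o m    with refl ← disjoint (t∈L o) m = contradiction o ¬o
    ... | kept ¬o m   | start o refl  with refl ← disjoint (t∈L o) m = contradiction o ¬o
    ... | later o m    | kept ¬o m′   with refl ← disjoint (tail∈ o m) m′ = contradiction (τ-on o) ¬o
    ... | kept ¬o m′  | later o m     with refl ← disjoint (tail∈ o m) m′ = contradiction (τ-on o) ¬o

    reroute-unique : ∀ i → Unique (reroute i)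
    reroute-unique i with on? i
    ... | no _  = unique i
    ... | yes o = All.tabulate (λ { v∈ refl → t∉rest o (τ-on o) (later∈rest o v∈) })
                  ∷ unique-suffix (mid i) (far-unique o)

    reroute-route : ∀ i → Route G Y (reroute i)
    reroute-route i with on? i
    ... | no _  = route i
    ... | yes o = edge o ∷ route-suffix (mid i) (subst (Route G Y) (far o)
                    (route-tail (subst (Route G Y) (tip (τ-on o)) (route (τ i)))))

    reroute-consec : ∀ {i u v} → On i → Consec (q i ∷ post i) u v → Link reroute u v
    reroute-consec {i} o c = i , inj₁ (subst (λ xs → Consec xs _ _) (≡-sym (reroute-on o)) (there c))

    link-sym : ∀ {M u v} → Link M u v → Link M v u
    link-sym (i , c) = i , Sum.swap c

    tail-link : ∀ {i u v} → On i → Link L u v → u ∈ q i ∷ post i →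
                Consec (mid i ++ q i ∷ post i) u v ⊎ (Consec (t (τ i) ∷ mid i ++ q i ∷ post i) v u)
    tail-link {i} {u} {v} o l u∈
      with subst (λ xs → Consec xs u v ⊎ Consec xs v u) (trans (tip (τ-on o)) (cong (t (τ i) ∷_) (far o)))
             (link-strand valid (tail∈ o u∈) l)
    ... | inj₂ c = inj₂ c
    ... | inj₁ c with consec-∷⁻ c
    ...   | inj₂ c′ = inj₁ c′
    ...   | inj₁ (refl , _) = contradiction (later∈rest o u∈) (t∉rest (τ-on o) (τ-on o))

    strand-unique : ∀ {i} → On i → Unique (t (τ i) ∷ mid i ++ q i ∷ post i)
    strand-unique {i} o = subst (λ xs → Unique (t (τ i) ∷ xs)) (far o) (rest-unique (τ-on o))

    -- Rerouting exchanges the extra edge of t i with its strand edge, and likewise for q i.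
    tip-extra : ∀ {i w} → On i → w on reroute → Adj G (t i) w → ¬ Link reroute (t i) w → head (rest i) ≡ just w
    tip-extra {i} o w-on tw ¬l
      with neighbour valid (i , t∈L o) (τ i , q∈L o) (edge o) (extra o) (reroute-within w-on) tw
    ... | inj₁ refl = contradiction (i , inj₁ (subst (λ xs → Consec xs _ _) (≡-sym (reroute-on o)) here)) ¬l
    ... | inj₂ l = link-tip valid (tip o) l

    mate-extra : ∀ {i w} → On i → w on reroute → Adj G (q i) w → ¬ Link reroute (q i) w →
                 Consec (t (τ i) ∷ mid i ++ q i ∷ post i) w (q i)
    mate-extra {i} o w-on qw ¬l
      with neighbour valid (τ i , q∈L o) (i , t∈L o) (adj-sym {G = G} (edge o)) (extra o ∘ link-sym) (reroute-within w-on) qw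
    ... | inj₁ refl = contradiction (i , inj₂ (subst (λ xs → Consec xs _ _) (≡-sym (reroute-on o)) here)) ¬l
    ... | inj₂ l with tail-link o l (here refl)
    ...   | inj₂ c = c
    ...   | inj₁ c = contradiction (reroute-consec o (consec-suffix (mid i) (far-unique o) c (here refl))) ¬l

    post-link : ∀ {i u v} → On i → u ∈ post i → Link L u v → Link reroute u v
    post-link {i} o u∈ l with tail-link o l (there u∈)
    ... | inj₁ c = reroute-consec o (consec-suffix (mid i) (far-unique o) c (there u∈))
    ... | inj₂ c = link-sym (reroute-consec o (consec-suffix-∷ (t (τ i) ∷ mid i) (strand-unique o) c u∈))

    off-link : ∀ {i u v} → ¬ On i → u ∈ L i → Link L u v → Link reroute u v
    off-link {i} ¬o u∈ l = i , subst (λ xs → Consec xs _ _ ⊎ Consec xs _ _) (≡-sym (reroute-off ¬o)) (link-strand valid u∈ l)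

    reroute-valid : Valid reroute
    reroute-valid = record
      { unique = reroute-unique ; disjoint = reroute-disjoint ; route = reroute-route ; few = few′ }
      where
      few′ : ∀ {v w w′} → v on reroute → w on reroute → w′ on reroute →
             Adj G v w → ¬ Link reroute v w → Adj G v w′ → ¬ Link reroute v w′ → w ≡ w′
      few′ (i , v∈) w-on w′-on vw ¬l vw′ ¬l′ with source v∈
      ... | start o refl = just-injective (trans (≡-sym (tip-extra o w-on vw ¬l)) (tip-extra o w′-on vw′ ¬l′))
      -- An extra edge of `q i` can now lead only to its predecessor on the old strand, and a vertex
      -- has just one predecessor.
      ... | later o (here refl) = consec-pred (strand-unique o) (mate-extra o w-on vw ¬l) (mate-extra o w′-on vw′ ¬l′)
      ... | later o (there v∈′) = few (τ i , tail∈ o (there v∈′)) (reroute-within w-on) (reroute-within w′-on)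
                              vw (¬l ∘ post-link o v∈′) vw′ (¬l′ ∘ post-link o v∈′)
      ... | kept ¬o v∈′ = few (i , v∈′) (reroute-within w-on) (reroute-within w′-on)
                           vw (¬l ∘ off-link ¬o v∈′) vw′ (¬l′ ∘ off-link ¬o v∈′)

    mid-gone : ∀ {i v} → On i → v ∈ mid i → ¬ v on reroute
    mid-gone {i} o v∈ (j , v∈′) with source v∈′
    ... | start o′ refl = t∉rest o′ (τ-on o) (far∈ o (∈-++⁺ˡ v∈))
    ... | later o′ m with refl ← τ-inj o o′ (disjoint (rest∈L (τ-on o) (far∈ o (∈-++⁺ˡ v∈))) (tail∈ o′ m))
      = unique-++ (mid i) (far-unique o) v∈ m
    ... | kept ¬o m with refl ← disjoint (rest∈L (τ-on o) (far∈ o (∈-++⁺ˡ v∈))) m = ¬o (τ-on o)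

    reroute-smaller : ∀ {i v} → On i → v ∈ mid i → Smaller reroute L
    reroute-smaller {i} {v} o v∈ =
      reroute-within , v , (τ i , rest∈L (τ-on o) (far∈ o (∈-++⁺ˡ v∈))) , mid-gone o v∈

    -- The tips are unchanged and no vertices are added; as `Half` depends on nothing else of the
    -- linkage, the same two paths serve for `L`.
    reroute-solvable : Solvable reroute → Solvable L
    reroute-solvable solve s with solve s
    ... | c , c∈ , A , B , hA , hB , ap = c , c∈ , A , B , half hA , half hB , ap
      where
      half : ∀ {i ks A} → Half reroute i ks A → Half L i ks A
      half {i} h = record
        { starts = trans starts (reroute-head i) ; isRoute = isRoute ; isUnique = isUnique
        ; inside = reroute-within ∘ inside
        ; avoids = λ {k} k∈ hd → avoids k∈ (trans (reroute-head k) hd) }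
        where open Half h

    -- With nothing to bypass, rerouting would not make the linkage smaller; progress comes from a
    -- turn instead.
    module Tight (tight : ∀ {i} → On i → mid i ≡ []) where

      turned : Strand → Strand
      turned i with on? i
      ... | yes _ = τ i
      ... | no  _ = i

      σ : Perm
      σ = tabulate turned

      σ-on : ∀ {i} → On i → lookup σ i ≡ τ i
      σ-on {i} o = trans (lookup∘tabulate turned i) turned-on
        where
        turned-on : turned i ≡ τ i
        turned-on with on? i
        ... | yes _ = refl
        ... | no ¬o = contradiction o ¬o

      σ-off : ∀ {i} → ¬ On i → lookup σ i ≡ i
      σ-off {i} ¬o = trans (lookup∘tabulate turned i) turned-off
        where
        turned-off : turned i ≡ i
        turned-off with on? i
        ... | yes o = contradiction o ¬o
        ... | no _  = refl

      rest-tight : ∀ {i} → On i → rest (τ i) ≡ q i ∷ post i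
      rest-tight {i} o = trans (far o) (cong (_++ q i ∷ post i) (tight o))

      -- Otherwise the extra edge would join the first two vertices of a single strand, and these
      -- are linked.
      τ≢ : ∀ {i} → On i → τ i ≢ i
      τ≢ {i} o eq = extra o (i , inj₁ (subst (λ xs → Consec xs (t i) (q i))
        (≡-sym (trans (tip o) (cong (t i ∷_) (trans (cong rest (≡-sym eq)) (rest-tight o))))) here))

      σ-moves : ∀ {i} → On i → lookup σ i ≢ i
      σ-moves o eq = τ≢ o (trans (≡-sym (σ-on o)) eq)

      moved-on : ∀ {i} → lookup σ i ≢ i → On i
      moved-on {i} m = decidable-stable (on? i) (m ∘ σ-off)

      -- `q` and `post` are indexed by the strand on which the extra edge starts, hence the
      -- preimage. Off the rotation the value is a filler.
      u : Strand → Fin n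
      u i with on? i
      ... | yes o = q (proj₁ (preimage o))
      ... | no  _ = t i

      R : Linkage
      R i with on? i
      ... | yes o = post (proj₁ (preimage o))
      ... | no  _ = L i

      shape : ∀ {i} → On i → L i ≡ t i ∷ u i ∷ R i
      shape {i} o with on? i
      ... | no ¬o = contradiction o ¬o
      ... | yes o′ with preimage o′
      ...   | j , oj , refl = trans (tip o) (cong (t i ∷_) (rest-tight oj))

      R-off : ∀ {i} → ¬ On i → R i ≡ L i
      R-off {i} ¬o with on? i
      ... | yes o = contradiction o ¬o
      ... | no _  = refl

      u-τ : ∀ {i} → On i → u (τ i) ≡ q i
      u-τ {i} o = just-injective (cong head (∷-injectiveʳ (trans (≡-sym (shape (τ-on o)))
        (trans (tip (τ-on o)) (cong (t (τ i) ∷_) (rest-tight o))))))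

      cut : Cut L R
      cut = record { prefix = λ i → prefix i (on? i) ; split = λ i → split i (on? i) }
        where
        prefix : ∀ i → Dec (On i) → List (Fin n)
        prefix i (yes _) = t i ∷ u i ∷ []
        prefix i (no  _) = []

        split : ∀ i o? → L i ≡ prefix i o? ++ R i
        split i (yes o) = shape o
        split i (no ¬o) = ≡-sym (R-off ¬o)

      σ-injective : Injective σ
      σ-injective i j eq with on? i | on? j
      ... | yes o | yes o′ = τ-inj o o′ (trans (≡-sym (σ-on o)) (trans eq (σ-on o′)))
      ... | no ¬o | no ¬o′ = trans (≡-sym (σ-off ¬o)) (trans eq (σ-off ¬o′))
      ... | yes o | no ¬o′ = contradiction
        (subst On (trans (≡-sym (σ-on o)) (trans eq (σ-off ¬o′))) (τ-on o)) ¬o′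
      ... | no ¬o | yes o′ = contradiction
        (subst On (trans (≡-sym (σ-on o′)) (trans (≡-sym eq) (σ-off ¬o))) (τ-on o′)) ¬o

      turning : Turn L R σ
      turning = record
        { t = t ; u = u ; injective = σ-injective
        ; shape = shape ∘ moved-on
        ; same = λ {i} eq → R-off λ o → σ-moves o eq
        ; edge = λ m → let o = moved-on m in
            subst (Adj G _) (≡-sym (trans (cong u (σ-on o)) (u-τ o))) (edge o)
        ; extra = λ m → let o = moved-on m in
            subst (λ v → ¬ Link L _ v) (≡-sym (trans (cong u (σ-on o)) (u-τ o))) (extra o)
        ; preimage = λ m → let j , oj , eq = preimage (moved-on m) in
            j , σ-moves oj , trans (σ-on oj) eq
        }

      R-smaller : Smaller R L
      R-smaller with i , o ← inhabited =
        cut-on valid cut , t i , (i , t∈L o) , dropped valid cut (t i ∷ u i ∷ []) (shape o) (here refl)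

  solution-≼ : ∀ {L c d} → d ≼ c ⊎ d ≼ swap c → Solution L c → Solution L d
  solution-≼ {L} {c} {d} (inj₁ le) sol = solution-weaken {L} {c} {d} le sol
  solution-≼ {L} {c} {d} (inj₂ le) sol = solution-weaken {L} {swap c} {d} le (solution-swap {L} {swap c} sol)

  -- A solution for the renamed rest is renamed back, weakened to a successor of a configuration of
  -- the present state, and prolonged by the leads of the moves that produce this successor.
  advance : ∀ {e L R} → Realises e L R → Permitted e →
            (∀ π → Injective π → Solvable (R ∘ lookup π)) → Solvable L
  advance {e} {L} {R} realises permitted solve s =
    let s′ , π , inj , covered = closed s permitted
        c′ , c′∈ , sol         = solve π inj s′
        d , d∈ , d≼            = find (All.lookup covered c′∈)
        c , c∈ , d∈′           = find (∈-concatMap⁻ (successors e) {xs = state s} d∈)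
        ms , admissible , eq   = ∈-successors⁻ {e} {c} d∈′
    in c , c∈ , solution-extend realises admissible
         (subst (Solution R) eq (solution-≼ {c = rename π c′} {d} d≼ (solution-rename {R} π sol)))

  -- Removing and classifying tips

  behead : Event → Linkage → Linkage
  behead e L i with touched? e i
  ... | yes _ = drop 1 (L i)
  ... | no  _ = L i

  behead-off : ∀ {e} {L : Linkage} {i} → ¬ Touched e i → behead e L i ≡ L i
  behead-off {e} {i = i} ¬τ with touched? e i
  ... | yes τ = contradiction τ ¬τ
  ... | no  _ = refl

  behead-on : ∀ {e} {L : Linkage} {i p vs} → Touched e i → L i ≡ p ∷ vs → L i ≡ p ∷ behead e L i
  behead-on {e} {L} {i} {p} τ eq with touched? e i
  ... | yes _ = trans eq (cong (λ xs → p ∷ drop 1 xs) (≡-sym eq))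
  ... | no ¬τ = contradiction τ ¬τ

  behead-cut : ∀ e L → Cut L (behead e L)
  behead-cut e L = record { prefix = λ i → proj₁ (split i) ; split = λ i → proj₂ (split i) }
    where
    split : ∀ i → ∃ λ us → L i ≡ us ++ behead e L i
    split i with touched? e i
    ... | yes _ = take 1 (L i) , ≡-sym (take++drop≡id 1 (L i))
    ... | no  _ = [] , refl

  record Mate : Set where
    field
      goal           : Strand
      tip first mate : Fin n
      rest mid post  : List (Fin n)

  record IsMate (L : Linkage) (i : Strand) (d : Mate) : Set where
    open Mate d
    field
      tip-eq : L i ≡ tip ∷ rest
      far-eq : L goal ≡ first ∷ mid ++ mate ∷ post
      edge   : Adj G tip mate
      extra  : ¬ Link L tip mate

  record Lone (L : Linkage) (i : Strand) : Set where
    field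
      {p}  : Fin n
      {vs} : List (Fin n)
      eq   : L i ≡ p ∷ vs
      lone : Closed L L p

  record Facing (L : Linkage) (i : Strand) : Set where
    field
      {j}     : Strand
      {p r}   : Fin n
      {vs ws} : List (Fin n)
      eq      : L i ≡ p ∷ vs
      eq′     : L j ≡ r ∷ ws
      edge    : Adj G p r
      extra   : ¬ Link L p r

  -- The question is where the extra edge of the tip leads: nowhere, to a tip, or deeper into some
  -- strand, possibly its own. The last case is a strand without tip.
  classify : ∀ L i → Lone L i ⊎ Facing L i ⊎ ∃ (IsMate L i) ⊎ L i ≡ []
  classify L i with L i in eq
  ... | []     = inj₂ (inj₂ (inj₂ refl))
  ... | p ∷ vs with anyFin? (λ q → anyFin? (λ j → member? _≟_ q (L j)) ×-dec (adj G p q ≟ᵇ true) ×-dec ¬? (link? L p q))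
  ...   | no none = inj₁ (record { eq = eq ; lone = λ {v} v-on pv →
            decidable-stable (link? L p v) λ ¬l → none (v , v-on , pv , ¬l) })
  ...   | yes (q , (j , q∈) , pq , ¬l) with L j in eq′
  ...     | r ∷ ws with q∈
  ...       | here refl = inj₂ (inj₁ (record { eq = eq ; eq′ = eq′ ; edge = pq ; extra = ¬l }))
  ...       | there q∈′ with us , ws′ , refl ← ∈-∃++ q∈′ =
    inj₂ (inj₂ (inj₁ (_ , record { tip-eq = eq ; far-eq = eq′ ; edge = pq ; extra = ¬l })))

  module _ {L : Linkage} (mated : ∀ i → ∃ (IsMate L i) ⊎ L i ≡ []) {i₀ d₀} (isMate₀ : IsMate L i₀ d₀) where

    private
      occupied? : Decidable (λ i → L i ≢ [])
      occupied? i with L i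
      ... | []    = no λ ne → ne refl
      ... | _ ∷ _ = yes λ ()

      -- The default `d₀` stands only on empty strands. Iteration starts on a nonempty strand and
      -- goals are nonempty, so it is never met.
      mateOf : Strand → Mate
      mateOf i = Sum.[ proj₁ , const d₀ ]′ (mated i)

      isMateOf : ∀ {i} → L i ≢ [] → IsMate L i (mateOf i)
      isMateOf {i} ne with mated i
      ... | inj₁ (_ , m) = m
      ... | inj₂ empty   = contradiction empty ne

      g : Strand → Strand
      g i = Mate.goal (mateOf i)

      g-nonempty : ∀ {i} → L i ≢ [] → L (g i) ≢ []
      g-nonempty ne eq with () ← trans (≡-sym eq) (IsMate.far-eq (isMateOf ne))

      pow-nonempty : ∀ k {i} → L i ≢ [] → L (pow g k i) ≢ []
      pow-nonempty zero    ne = ne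
      pow-nonempty (suc k) ne = g-nonempty (pow-nonempty k ne)

    rotation : Rotation L
    rotation = periodic⇒rotation (eventually-periodic g i₀)
      where
      nonempty₀ : L i₀ ≢ []
      nonempty₀ eq with () ← trans (≡-sym eq) (IsMate.tip-eq isMate₀)

      periodic⇒rotation : (∃₂ λ k c → pow g (suc c) (pow g k i₀) ≡ pow g k i₀) → Rotation L
      periodic⇒rotation (k , c , periodic) = record
        -- Taking all nonempty strands fixed by this power of `g`, possibly from several cycles,
        -- makes membership decidable at once.
        { On        = λ i → L i ≢ [] × pow g (suc c) i ≡ i
        ; on?       = λ i → occupied? i ×-dec (pow g (suc c) i ≟ i)
        ; τ         = g
        ; τ-on      = λ {i} (ne , eq) → g-nonempty ne , trans (pow-suc g (suc c) i) (cong g eq)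
        -- pow g c inverts g on the strands whose period divides suc c.
        ; τ-inj     = λ {i} {j} (_ , eq) (_ , eq′) gg →
            trans (≡-sym eq) (trans (≡-sym (pow-suc g c i)) (trans (cong (pow g c) gg) (trans (pow-suc g c j) eq′)))
        ; preimage  = λ {i} (ne , eq) → pow g c i ,
            (pow-nonempty c ne , trans (≡-sym (pow-+ g (suc c) c i)) (trans (cong (λ l → pow g l i) (+-comm (suc c) c))
              (trans (pow-+ g c (suc c) i) (cong (pow g c) eq)))) , eq
        ; inhabited = pow g k i₀ , pow-nonempty k nonempty₀ , periodic
        ; t = λ i → Mate.tip (mateOf i) ; q = λ i → Mate.mate (mateOf i)
        ; rest = λ i → Mate.rest (mateOf i) ; mid = λ i → Mate.mid (mateOf i) ; post = λ i → Mate.post (mateOf i)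
        ; tip       = λ (ne , _) → IsMate.tip-eq (isMateOf ne)
        -- The strand `g i` is described twice, from its own tip and as the goal of `i`; dropping
        -- the first vertex identifies the two descriptions.
        ; far       = λ (ne , _) → ∷-injectiveʳ (trans (≡-sym (IsMate.tip-eq (isMateOf (g-nonempty ne))))
                                     (IsMate.far-eq (isMateOf ne)))
        ; edge      = λ (ne , _) → IsMate.edge (isMateOf ne)
        ; extra     = λ (ne , _) → IsMate.extra (isMateOf ne)
        }

  -- The induction on linkages

  module _ {L : Linkage} (valid : Valid L) (solve : ∀ {R} → Smaller R L → Valid R → Solvable R) where
    open Valid valid

    solve-renamed : ∀ {R} → Cut L R → (∃ λ v → v on L × ¬ v on R) →
                    ∀ π → Injective π → Solvable (R ∘ lookup π)
    solve-renamed cut (v , v-on , ¬v-on) π inj =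
      solve ((λ (i , v∈) → cut-on valid cut (lookup π i , v∈)) , v , v-on , λ (i , v∈) → ¬v-on (lookup π i , v∈))
        (rename-valid (cut-valid valid cut) {π} inj)

    skip-step : ∀ {k} → Lone L k → Solvable L
    skip-step {k} record { p = p ; eq = eq ; lone = lone } =
      advance (skip-realises valid cut eq′ (λ ≢k → behead-off {L = L} ≢k) (lone ∘ cut-on valid cut))
        _
        (solve-renamed cut (p , (k , head-∈ (cong head eq)) , dropped valid cut (p ∷ []) eq′ (here refl)))
      where
      cut = behead-cut (skip k) L
      eq′ : L k ≡ p ∷ behead (skip k) L k
      eq′ = behead-on {skip k} refl eq

    meet-step : ∀ {k} → Facing L k → Solvable L
    meet-step {k} record { j = l ; p = p ; r = r ; eq = eq ; eq′ = eq′ ; edge = edge ; extra = extra } =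
      advance (meet-realises valid cut k≢l at-k at-l
                (λ ≢k ≢l → behead-off {L = L} Sum.[ ≢k , ≢l ]) edge closed-p closed-r)
        _
        (solve-renamed cut (p , p-on , gone at-k))
      where
      cut = behead-cut (meet k l) L

      at-k : L k ≡ p ∷ behead (meet k l) L k
      at-k = behead-on {meet k l} (inj₁ refl) eq

      at-l : L l ≡ r ∷ behead (meet k l) L l
      at-l = behead-on {meet k l} (inj₂ refl) eq′

      p-on : p on L
      p-on = k , head-∈ (cong head eq)

      r-on : r on L
      r-on = l , head-∈ (cong head eq′)

      gone : ∀ {i v} → L i ≡ v ∷ behead (meet k l) L i → ¬ v on behead (meet k l) L
      gone {v = v} at = dropped valid cut (v ∷ []) at (here refl)

      k≢l : k ≢ l
      k≢l refl with refl ← ∷-injectiveˡ (trans (≡-sym eq) eq′) = adj-irrefl {G = G} edge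

      closed-p : Closed L (behead (meet k l) L) p
      closed-p v-on pv with neighbour valid p-on r-on edge extra (cut-on valid cut v-on) pv
      ... | inj₁ refl = contradiction v-on (gone at-l)
      ... | inj₂ l    = l

      closed-r : Closed L (behead (meet k l) L) r
      closed-r v-on rv
        with neighbour valid r-on p-on (adj-sym {G = G} edge) (λ (i , c) → extra (i , Sum.swap c)) (cut-on valid cut v-on) rv
      ... | inj₁ refl = contradiction v-on (gone at-k)
      ... | inj₂ l    = l

    rotation-step : Rotation L → Solvable L
    rotation-step rot = Sum.[ loose , tight-step ]′ (search inspect-mid)
      where
      open Rotation rot

      inspect-mid : ∀ i → (On i × ∃ λ v → v ∈ mid i) ⊎ (On i → mid i ≡ [])
      inspect-mid i with on? i
      ... | no ¬o = inj₂ λ o → contradiction o ¬o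
      ... | yes o with mid i
      ...   | []    = inj₂ λ _ → refl
      ...   | v ∷ _ = inj₁ (o , v , here refl)

      loose : (∃ λ i → On i × ∃ λ v → v ∈ mid i) → Solvable L
      loose (_ , o , _ , v∈) =
        reroute-solvable valid rot (solve (reroute-smaller valid rot o v∈) (reroute-valid valid rot))

      tight-step : (∀ i → On i → mid i ≡ []) → Solvable L
      tight-step tight = advance (turn-realises valid cut turning) σ-injective
        (solve-renamed cut (proj₂ R-smaller))
        where open Tight valid rot (λ {i} → tight i)

    -- Used-up strands count as having arrived, so two empty paths solve every configuration, and
    -- each state contains one.
    empty-step : (∀ i → L i ≡ []) → Solvable L
    empty-step empty s with c , c∈ ← nonempty s = c , c∈ , [] , [] , half , half , λ ()
      where
      half : ∀ {i ks} → Half L i ks []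
      half {i} = record { starts = cong head (≡-sym (empty i)) ; isRoute = [] ; isUnique = []
                        ; inside = λ () ; avoids = λ _ _ () }

    -- The order of the cases matters: a rotation can be found once every remaining tip is known to
    -- have its extra edge lead deeper into a strand.
    step : Solvable L
    step = Sum.[ (λ (_ , lone) → skip-step lone) , (λ ¬lone →
           Sum.[ (λ (_ , facing) → meet-step facing) , (λ mated →
           Sum.[ (λ (_ , _ , isMate) → rotation-step (rotation mated isMate)) , empty-step ]′
             (search mated)) ]′ (search ¬lone)) ]′ (search (classify L))

  -- The induction runs over a bound for the size of a finite set `U` around the linkage; a vertex
  -- lost in a step is deleted from `U`.
  valid⇒solvable : ∀ N (U : Subset n) {L} → ∣ U ∣ < N → (∀ {v} → v on L → v ∈ₛ U) → Valid L → Solvable L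
  valid⇒solvable (suc N) U (s≤s ∣U∣≤N) L⊆U valid = step valid λ (R⊆L , v , v-on , ¬v-on) →
    valid⇒solvable N (U - v) (<-≤-trans (x∈p⇒∣p-x∣<∣p∣ (L⊆U v-on)) ∣U∣≤N)
      (λ w-on → x∈p∧x≢y⇒x∈p-y (L⊆U (R⊆L w-on)) λ { refl → ¬v-on w-on })

-- Two non-adjacent paths from five disjoint ones

module _ {n} (G : Graph n) (X Y : VSet n) (𝒫 : Fin 5 → Path G)
         (linked : DisjointXYPaths G X Y 5 𝒫) (few : FewExtraEdges G 𝒫) where
  open Linkages G Y

  private
    tours : ∀ i → Tour X Y (𝒫 i)
    tours i = orient (𝒫 i) (proj₁ linked i)

    L : Linkage
    L i = Tour.tour (tours i)

    on⇒InV : ∀ {v} → v on L → InV𝒫 𝒫 v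
    on⇒InV (i , v∈) = i , Tour.inside (tours i) v∈

    InE⇒Link : ∀ {u v} → InE𝒫 𝒫 u v → Link L u v
    InE⇒Link (i , e) = i , Tour.edges (tours i) e

    tours-valid : Valid L
    tours-valid = record
      { unique   = λ i → Tour.isUnique (tours i)
      ; disjoint = λ {i} {j} v∈ v∈′ → decidable-stable (i ≟ j) λ i≢j →
          proj₂ linked i j i≢j _ (Tour.inside (tours i) v∈) (Tour.inside (tours j) v∈′)
      ; route    = λ i → Tour.isRoute (tours i)
      ; few      = λ v-on _ _ vw ¬l vw′ ¬l′ →
          few _ (on⇒InV v-on) _ _ vw (¬l ∘ InE⇒Link) vw′ (¬l′ ∘ InE⇒Link)
      }

    toPath : ∀ {i ks A} → Half L i ks A → Σ (Path G) λ P → IsXYPath X Y P × (∀ {v} → v ∈V P → v ∈ A)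
    toPath {i} {A = []} h with () ← trans (Half.starts h) (Tour.starts (tours i))
    toPath {i} {A = a ∷ A} h = mkPath (a ∷ A) isUnique (route⇒walk isRoute) ,
      inj₁ (subst X (just-injective (≡-sym (trans starts (Tour.starts (tours i))))) (Tour.source∈X (tours i)) ,
            route⇒last isRoute) , λ v∈ → v∈
      where open Half h

  five-paths : HasTwoNonAdjacentXYPaths G X Y
  five-paths =
    let _ , _ , A , B , hA , hB , ap =
          -- Any state would serve in place of `zero`: all tips lie in `X`, so every solved
          -- configuration yields two X-Y-paths.
          Descent.valid⇒solvable G Y closedFamily (suc ∣ full {n} ∣) full (n<1+n _) (λ _ → ∈⊤) tours-valid zero
        P , xyP , P⊆A = toPath hA
        Q , xyQ , Q⊆B = toPath hB
    in P , Q , xyP , xyQ , (λ v v∈P v∈Q → proj₁ (ap (P⊆A v∈P) (Q⊆B v∈Q)) refl) ,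
       λ u v u∈P v∈Q → proj₂ (ap (P⊆A u∈P) (Q⊆B v∈Q))

-- Exhaustive search

infix 4 _∈ᵇ_
_∈ᵇ_ : ℕ → List ℕ → Bool
x ∈ᵇ xs = any (x ≡ᵇ_) xs

∈ᵇ⇒∈ : ∀ {x} xs → T (x ∈ᵇ xs) → x ∈ xs
∈ᵇ⇒∈ {x} xs t = Any.map (≡ᵇ⇒≡ x _) (any⁻ (x ≡ᵇ_) xs t)

∈⇒∈ᵇ : ∀ {x xs} → x ∈ xs → T (x ∈ᵇ xs)
∈⇒∈ᵇ {x} x∈ = any⁺ (x ≡ᵇ_) (Any.map (≡⇒≡ᵇ x _) x∈)

module Exhaustion (nb : ℕ → List ℕ) (xs ys : List ℕ) where

  ball : List ℕ → List ℕ
  ball as = as ++ concatMap nb as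

  -- Vertices that are in `seen` from the beginning are never expanded; a flood that starts with a
  -- ball as `seen` therefore explores only its outside.
  flood : ℕ → List ℕ → List ℕ → List ℕ
  flood (suc k) seen (v ∷ stack) =
    if v ∈ᵇ seen then flood k seen stack else flood k (v ∷ seen) (nb v ++ stack)
  flood _ seen _ = seen

  -- Outside N, the set S is closed under neighbours, contains xs and misses ys.
  separatedᵇ : List ℕ → List ℕ → Bool
  separatedᵇ N S =
    all (_∈ᵇ S) xs ∧ all (λ v → (v ∈ᵇ N) ∨ all (_∈ᵇ S) (nb v)) S ∧ all (λ v → (v ∈ᵇ N) ∨ not (v ∈ᵇ S)) ys

  -- The fuel of flood cannot harm soundness, since separatedᵇ checks the outcome.
  blocksᵇ : List ℕ → Bool
  blocksᵇ as = separatedᵇ (ball as) (flood 200 (ball as) xs)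

  -- v ∷ as is the beginning of a path from xs, listed backwards.
  exhaustᵇ : ℕ → ℕ → List ℕ → Bool
  exhaustᵇ k v as = blocksᵇ (v ∷ as) ∨ not (v ∈ᵇ ys) ∧ continue k
    where
    continue : ℕ → Bool
    continue zero    = false
    continue (suc k) = all (λ w → (w ∈ᵇ (v ∷ as)) ∨ exhaustᵇ k w (v ∷ as)) (nb v)

  module _ {n} (G : Graph n) (X Y : VSet n)
           (adj≡nb : ∀ u v → adj G u v ≡ (toℕ v ∈ᵇ nb (toℕ u)))
           (X⇒xs : ∀ {v} → X v → toℕ v ∈ xs) (Y⇒ys : ∀ {v} → Y v → toℕ v ∈ ys) where

    complete : ∀ {u v} → Adj G u v → toℕ v ∈ nb (toℕ u)
    complete {u} {v} uv = ∈ᵇ⇒∈ (nb (toℕ u)) (Equivalence.from T-≡ (trans (≡-sym (adj≡nb u v)) uv))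

    sound : ∀ {u v} → toℕ v ∈ nb (toℕ u) → Adj G u v
    sound {u} {v} v∈ = trans (adj≡nb u v) (Equivalence.to T-≡ (∈⇒∈ᵇ v∈))

    Avoids : List ℕ → List (Fin n) → Set
    Avoids N B = ∀ {v} → v ∈ B → toℕ v ∉ N

    -- Starting in `S`, a route that avoids `N` cannot leave `S`, and outside `N` there is no vertex
    -- of `Y` in `S` at which it could end.
    separated-sound : ∀ N S → T (separatedᵇ N S) → ∀ {b B} → Route G Y (b ∷ B) → X b → ¬ Avoids N (b ∷ B)
    separated-sound N S sep {b} {B} r x avoids = traverse r (All.lookup (all⁺ (_∈ᵇ S) xs sep₁) (X⇒xs x)) avoids
      where
      sep₁ = proj₁ (Equivalence.to T-∧ sep)
      sep₂₃ = Equivalence.to T-∧ (proj₂ (Equivalence.to (T-∧ {all (_∈ᵇ S) xs}) sep))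

      traverse : ∀ {v vs} → Route G Y (v ∷ vs) → T (toℕ v ∈ᵇ S) → ¬ Avoids N (v ∷ vs)
      traverse {v} (end y) v∈S av
        with Equivalence.to (T-∨ {toℕ v ∈ᵇ N}) (All.lookup (all⁺ _ ys (proj₂ sep₂₃)) (Y⇒ys y))
      ... | inj₁ v∈N = av (here refl) (∈ᵇ⇒∈ N v∈N)
      ... | inj₂ v∉S = subst T (Equivalence.to T-not-≡ v∉S) v∈S
      traverse {v} (vw ∷ r) v∈S av
        with Equivalence.to (T-∨ {toℕ v ∈ᵇ N}) (All.lookup (all⁺ _ S (proj₁ sep₂₃)) (∈ᵇ⇒∈ S v∈S))
      ... | inj₁ v∈N = av (here refl) (∈ᵇ⇒∈ N v∈N)
      ... | inj₂ nb⊆S = traverse r (All.lookup (all⁺ (_∈ᵇ S) (nb (toℕ v)) nb⊆S) (complete vw)) (av ∘ there)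

    apart⇒avoids : ∀ {as B} → (∀ {u w} → u ∈ as → w ∈ B → u ≢ w × ¬ Adj G u w) → Avoids (ball (map toℕ as)) B
    apart⇒avoids {as} apart {v} v∈B v∈N with ∈-++⁻ (map toℕ as) v∈N
    ... | inj₁ v∈as with u , u∈ , eq ← ∈-map⁻ toℕ v∈as = proj₁ (apart u∈ v∈B) (toℕ-injective (≡-sym eq))
    ... | inj₂ v∈nb with _ , w∈ , v∈ ← find (∈-concatMap⁻ nb {xs = map toℕ as} v∈nb)
                    with u , u∈ , refl ← ∈-map⁻ toℕ w∈ = proj₂ (apart u∈ v∈B) (sound v∈)

    blocks-sound : ∀ as → T (blocksᵇ as) → ∀ {b B} → Route G Y (b ∷ B) → X b → ¬ Avoids (ball as) (b ∷ B)
    blocks-sound as = separated-sound (ball as) (flood 200 (ball as) xs)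

    -- The search follows the first path, with `as` behind and `v ∷ vs` ahead. An unblocked end in
    -- `Y` or a lack of fuel makes the search fail, so if it succeeds, some initial part of the path
    -- blocks the second path.
    exhaust-sound : ∀ k {v vs as} → T (exhaustᵇ k (toℕ v) (map toℕ as)) → Route G Y (v ∷ vs) →
                    Unique (v ∷ vs) → (∀ {w} → w ∈ v ∷ vs → w ∉ as) →
                    ∀ {b B} → Route G Y (b ∷ B) → X b →
                    ¬ (∀ {u w} → u ∈ as ⊎ u ∈ v ∷ vs → w ∈ b ∷ B → u ≢ w × ¬ Adj G u w)
    exhaust-sound k {v} {vs} {as} t r uniq fresh rB x apart
      with Equivalence.to (T-∨ {blocksᵇ (toℕ v ∷ map toℕ as)}) t
    ... | inj₁ blocked = blocks-sound (toℕ v ∷ map toℕ as) blocked rB x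
      (apart⇒avoids {v ∷ as} λ { (here refl) → apart (inj₂ (here refl)) ; (there u∈) → apart (inj₁ u∈) })
    ... | inj₂ t′ with Equivalence.to (T-∧ {not (toℕ v ∈ᵇ ys)}) t′
    exhaust-sound k {v} t (end y) uniq fresh rB x apart | inj₂ t′ | ¬y , _ =
      subst T (Equivalence.to T-not-≡ ¬y) (∈⇒∈ᵇ (Y⇒ys y))
    exhaust-sound (suc k) {v} {w ∷ vs} {as} t (vw ∷ r) (v≢ ∷ uniq) fresh rB x apart | inj₂ t′ | _ , t″
      with Equivalence.to (T-∨ {toℕ w ∈ᵇ (toℕ v ∷ map toℕ as)}) (All.lookup (all⁺ _ (nb (toℕ v)) t″) (complete vw))
    -- Branches that return to the walked part are cut off, rightly so: the path repeats no vertex.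
    ... | inj₁ w∈ with u , u∈ , eq ← ∈-map⁻ toℕ {xs = v ∷ as} (∈ᵇ⇒∈ (toℕ v ∷ map toℕ as) w∈)
                  with refl ← toℕ-injective {i = w} {u} eq with u∈
    ...   | here refl = All.lookup v≢ (here refl) refl
    ...   | there u∈′ = fresh (there (here refl)) u∈′
    exhaust-sound (suc k) {v} {w ∷ vs} {as} t (vw ∷ r) (v≢ ∷ uniq) fresh rB x apart | inj₂ t′ | _ , t″
      | inj₂ t‴ = exhaust-sound k {w} {vs} {v ∷ as} t‴ r uniq
        (λ { u∈ (here refl) → All.lookup v≢ u∈ refl ; u∈ (there u∈′) → fresh (there u∈) u∈′ })
        rB x (λ { (inj₁ (here refl)) → apart (inj₂ (here refl)) ; (inj₁ (there u∈)) → apart (inj₁ u∈)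
                ; (inj₂ u∈) → apart (inj₂ (there u∈)) })

    exhausted : ∀ k → T (all (λ x → exhaustᵇ k x []) xs) → ¬ HasTwoNonAdjacentXYPaths G X Y
    exhausted k t (P , Q , xyP , xyQ , disjoint , nonadj) with orient P xyP | orient Q xyQ
    ... | record { tour = p ∷ ps ; starts = refl ; source∈X = x ; isRoute = r ; isUnique = u ; inside = inP }
        | record { tour = q ∷ qs ; starts = refl ; source∈X = x′ ; isRoute = r′ ; inside = inQ } =
      exhaust-sound k {as = []} (All.lookup (all⁺ _ xs t) (X⇒xs x)) r u (λ _ ()) r′ x′
        λ { (inj₂ u∈) w∈ → (λ { refl → disjoint _ (inP u∈) (inQ w∈) }) , nonadj _ _ (inP u∈) (inQ w∈) }

-- Counterexamples

entry : List (List ℕ) → ℕ → List ℕ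
entry (r ∷ _)  zero    = r
entry (_ ∷ rs) (suc k) = entry rs k
entry []       _       = []

module Table {n : ℕ} (table : List (List ℕ)) where

  edgeᵇ : Fin n → Fin n → Bool
  edgeᵇ u v = toℕ v ∈ᵇ entry table (toℕ u)

  symmetric? : Dec (∀ u v → edgeᵇ u v ≡ edgeᵇ v u)
  symmetric? = allFin? λ u → allFin? λ v → edgeᵇ u v ≟ᵇ edgeᵇ v u

  loopless? : Dec (∀ v → edgeᵇ v v ≡ false)
  loopless? = allFin? λ v → edgeᵇ v v ≟ᵇ false

  graph : True symmetric? → True loopless? → Graph n
  graph s l = record { adj = edgeᵇ ; sym = toWitness s ; irrefl = toWitness l }

module _ {n} (G : Graph n) where

  walk? : ∀ vs → Dec (Walk G vs)
  walk? []           = yes tt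
  walk? (_ ∷ [])     = yes tt
  walk? (u ∷ v ∷ vs) = (adj G u v ≟ᵇ true) ×-dec walk? (v ∷ vs)

  path : ∀ (vs : List⁺ (Fin n)) → {True (unique? _≟_ (toList vs))} → {True (walk? (toList vs))} → Path G
  path vs {u} {w} = mkPath vs (toWitness u) (toWitness w)

  module Ends {k} (𝒫 : Fin k → Path G) where

    Sources Sinks : VSet n
    Sources v = ∃ λ i → v ≡ List⁺.head (verts (𝒫 i))
    Sinks   v = ∃ λ i → v ≡ last (verts (𝒫 i))

    sources sinks : List ℕ
    sources = List.tabulate λ i → toℕ (List⁺.head (verts (𝒫 i)))
    sinks   = List.tabulate λ i → toℕ (last (verts (𝒫 i)))

    source∈ : ∀ {v} → Sources v → toℕ v ∈ sources
    source∈ (i , refl) = ∈-tabulate⁺ i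

    sink∈ : ∀ {v} → Sinks v → toℕ v ∈ sinks
    sink∈ (i , refl) = ∈-tabulate⁺ i

    disjoint? : Dec (∀ i j → i ≢ j → All (λ v → ¬ (v ∈V 𝒫 j)) (toList (verts (𝒫 i))))
    disjoint? = allFin? λ i → allFin? λ j → ¬? (i ≟ j) →-dec
      all? (λ v → ¬? (member? _≟_ v (toList (verts (𝒫 j))))) (toList (verts (𝒫 i)))

    linked : True disjoint? → DisjointXYPaths G Sources Sinks k 𝒫
    linked d = (λ i → inj₁ ((i , refl) , (i , refl))) , λ i j i≢j v v∈ → All.lookup (toWitness d i j i≢j) v∈

    inE? : ∀ u v → Dec (InE𝒫 𝒫 u v)
    inE? u v = anyFin? λ i → consec? _≟_ (toList (verts (𝒫 i))) u v ⊎-dec consec? _≟_ (toList (verts (𝒫 i))) v u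

    -- Naming the only possible extra neighbour of each vertex reduces the condition from triples of
    -- vertices to pairs.
    mated? : (mate : Fin n → Fin n) → Dec (∀ v w → Adj G v w → ¬ InE𝒫 𝒫 v w → w ≡ mate v)
    mated? mate = allFin? λ v → allFin? λ w → (adj G v w ≟ᵇ true) →-dec ¬? (inE? v w) →-dec (w ≟ mate v)

    few : ∀ mate → True (mated? mate) → FewExtraEdges G 𝒫
    few mate m v _ w w′ vw ¬e vw′ ¬e′ = trans (toWitness m v w vw ¬e) (≡-sym (toWitness m v w′ vw′ ¬e′))

-- The extra edges join v and 31 − v. For v = 0, …, 15 they join the strands
-- 01 23 02 03 12 01 13 23 02 03 12 01 23 13 03 12.
table₄ : List (List ℕ)
table₄ =
  (2 ∷ 31 ∷ []) ∷ (29 ∷ 30 ∷ []) ∷ (0 ∷ 3 ∷ 29 ∷ []) ∷ (2 ∷ 5 ∷ 28 ∷ []) ∷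
  (26 ∷ 27 ∷ 31 ∷ []) ∷ (3 ∷ 8 ∷ 26 ∷ []) ∷ (10 ∷ 25 ∷ 26 ∷ []) ∷ (23 ∷ 24 ∷ 27 ∷ []) ∷
  (5 ∷ 9 ∷ 23 ∷ []) ∷ (8 ∷ 11 ∷ 22 ∷ []) ∷ (6 ∷ 20 ∷ 21 ∷ []) ∷ (9 ∷ 14 ∷ 20 ∷ []) ∷
  (16 ∷ 19 ∷ 21 ∷ []) ∷ (15 ∷ 18 ∷ 20 ∷ []) ∷ (11 ∷ 17 ∷ []) ∷ (13 ∷ 16 ∷ []) ∷
  (12 ∷ 15 ∷ []) ∷ (14 ∷ 18 ∷ []) ∷ (13 ∷ 17 ∷ 19 ∷ []) ∷ (12 ∷ 18 ∷ 22 ∷ []) ∷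
  (10 ∷ 11 ∷ 13 ∷ []) ∷ (10 ∷ 12 ∷ 23 ∷ []) ∷ (9 ∷ 19 ∷ 24 ∷ []) ∷ (7 ∷ 8 ∷ 21 ∷ []) ∷
  (7 ∷ 22 ∷ 25 ∷ []) ∷ (6 ∷ 24 ∷ 28 ∷ []) ∷ (4 ∷ 5 ∷ 6 ∷ []) ∷ (4 ∷ 7 ∷ 29 ∷ []) ∷
  (3 ∷ 25 ∷ 30 ∷ []) ∷ (1 ∷ 2 ∷ 27 ∷ []) ∷ (1 ∷ 28 ∷ []) ∷ (0 ∷ 4 ∷ []) ∷
  []

G₄ : Graph 32
G₄ = Table.graph table₄ _ _

𝒫₄ : Fin 4 → Path G₄
𝒫₄ = λ where
  ⓪ → path G₄ (# 0 ∷ # 2 ∷ # 3 ∷ # 5 ∷ # 8 ∷ # 9 ∷ # 11 ∷ # 14 ∷ [])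
  ① → path G₄ (# 31 ∷ # 4 ∷ # 26 ∷ # 6 ∷ # 10 ∷ # 20 ∷ # 13 ∷ # 15 ∷ [])
  ② → path G₄ (# 1 ∷ # 29 ∷ # 27 ∷ # 7 ∷ # 23 ∷ # 21 ∷ # 12 ∷ # 16 ∷ [])
  ③ → path G₄ (# 30 ∷ # 28 ∷ # 25 ∷ # 24 ∷ # 22 ∷ # 19 ∷ # 18 ∷ # 17 ∷ [])

-- The vertices `0` to `4` form the outer cycle, `5` to `9` the inner pentagram, and the spoke at
-- `i` ends at `i + 5`.
petersen : List (List ℕ)
petersen =
  (1 ∷ 4 ∷ 5 ∷ []) ∷ (0 ∷ 2 ∷ 6 ∷ []) ∷ (1 ∷ 3 ∷ 7 ∷ []) ∷ (2 ∷ 4 ∷ 8 ∷ []) ∷ (0 ∷ 3 ∷ 9 ∷ []) ∷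
  (0 ∷ 7 ∷ 8 ∷ []) ∷ (1 ∷ 8 ∷ 9 ∷ []) ∷ (2 ∷ 5 ∷ 9 ∷ []) ∷ (3 ∷ 5 ∷ 6 ∷ []) ∷ (4 ∷ 6 ∷ 7 ∷ []) ∷
  []

G₅ : Graph 10
G₅ = Table.graph petersen _ _

𝒫₅ : Fin 5 → Path G₅
𝒫₅ = λ where
  ⓪ → path G₅ (# 0 ∷ # 5 ∷ [])
  ① → path G₅ (# 1 ∷ # 6 ∷ [])
  ② → path G₅ (# 2 ∷ # 7 ∷ [])
  ③ → path G₅ (# 3 ∷ # 8 ∷ [])
  ④ → path G₅ (# 4 ∷ # 9 ∷ [])

linked₄ : DisjointXYPaths G₄ (Ends.Sources G₄ 𝒫₄) (Ends.Sinks G₄ 𝒫₄) 4 𝒫₄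
linked₄ = Ends.linked G₄ 𝒫₄ _

few₄ : FewExtraEdges G₄ 𝒫₄
-- `opposite` sends `v` to `31 - v`, the other end of its extra edge.
few₄ = Ends.few G₄ 𝒫₄ opposite _

module E₄ = Ends G₄ 𝒫₄
module E₅ = Ends G₅ 𝒫₅

none₄ : ¬ HasTwoNonAdjacentXYPaths G₄ E₄.Sources E₄.Sinks
none₄ = Exhaustion.exhausted (entry table₄) E₄.sources E₄.sinks G₄ E₄.Sources E₄.Sinks
  -- The fuel is the number of vertices, which no path exceeds.
  (λ _ _ → refl) E₄.source∈ E₄.sink∈ 32 _

none₅ : ¬ HasTwoNonAdjacentXYPaths G₅ E₅.Sources E₅.Sinks
none₅ = Exhaustion.exhausted (entry petersen) E₅.sources E₅.sinks G₅ E₅.Sources E₅.Sinks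
  (λ _ _ → refl) E₅.source∈ E₅.sink∈ 10 _

theorem1p8 : (∀ (n : ℕ) (G : Graph n) (X Y : VSet n) (𝒫 : Fin 5 → Path G) →
    DisjointXYPaths G X Y 5 𝒫 → FewExtraEdges G 𝒫 →
    HasTwoNonAdjacentXYPaths G X Y)
    ×
    (Σ ℕ λ n → Σ (Graph n) λ G → Σ (VSet n) λ X → Σ (VSet n) λ Y →
    Σ (Fin 4 → Path G) λ 𝒫 →
    DisjointXYPaths G X Y 4 𝒫 × FewExtraEdges G 𝒫 ×
    ¬ HasTwoNonAdjacentXYPaths G X Y)
    ×
    (Σ ℕ λ n → Σ (Graph n) λ G → Σ (VSet n) λ X → Σ (VSet n) λ Y →
    Σ (Fin 5 → Path G) λ 𝒫 →
    MaxDegree G 3 × DisjointXYPaths G X Y 5 𝒫 ×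
    ¬ HasTwoNonAdjacentXYPaths G X Y)
theorem1p8 =
    (λ _ → five-paths)
  , (32 , G₄ , E₄.Sources , E₄.Sinks , 𝒫₄ , linked₄ , few₄ , none₄)
  , (10 , G₅ , E₅.Sources , E₅.Sinks , 𝒫₅ ,
     (from-yes (allFin? λ v → degree G₅ v ≤? 3) , zero , refl) , E₅.linked _ , none₅)
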